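{- $\mathsf{CAC}$ does not prove $\mathsf{EM}$ over $\mathsf{RCA}_0$ (and hence $\mathsf{ADS}$ does not prove $\mathsf{EM}$ over $\mathsf{RCA}_0$ either).
   Context: All principles are statements of second order arithmetic; infinite structures have domain $\mathbb{N}$. $\mathsf{CAC}$: every infinite poset $M=(\mathbb{N},\preceq_M)$ contains an infinite chain (a set any two of whose elements are comparable) or an infinite antichain (a set any two distinct elements of which are incomparable). $\mathsf{ADS}$: for every infinite linear order $L=(\mathbb{N},<_L)$ there is an $f:\mathbb{N}\to\mathbb{N}$ with either $f(n)<_L f(m)$ for all $n<m$, or $f(n)>_L f(m)$ for all $n<m$. An infinite tournament is an irreflexive binary relation $T$ on $\mathbb{N}$ such that for all $x\neq y$ exactly one of $T(x,y)$, $T(y,x)$ holds. $\mathsf{EM}$: every infinite tournament $T$ contains an infinite transitive subtournament, i.e. an infinite set $S$ on which the relation $T$ is transitive. -}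

module Defs where

open import Data.Fin.Base using (Fin; zero; suc; lift)
open import Data.Fin.Patterns using (0F; 1F; 2F; 3F)
open import Data.List.Base using (List; []; _∷_; map)
open import Data.List.Membership.Propositional using (_∈_)
open import Data.Nat.Base using (ℕ; zero; suc)
import Data.Vec.Functional as Vector
open import Function.Base using (id; _∘_)
open import Level using (0ℓ)
open import Relation.Unary using (Pred)

-- The two-sorted language of second order arithmetic, with well-scoped
-- de Bruijn indices: n free number variables and k free set variables.
-- Variables are the only set terms, and equality is primitive for
-- numbers only (equality of sets is, as usual, extensional and defined).

infixl 7 _·_
infixl 6 _+_
infix  5 _≐_ _⋖_ _ϵ_
infixr 4 _∧_
infixr 3 _∨_
infixr 2 _⇒_
infix  1 _⇔_

data Term (n : ℕ) : Set where
  var : Fin n → Term n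
  𝟎 𝟏 : Term n
  _+_ : Term n → Term n → Term n
  _·_ : Term n → Term n → Term n

data Formula (n k : ℕ) : Set where
  _≐_ : Term n → Term n → Formula n k
  _⋖_ : Term n → Term n → Formula n k
  _ϵ_ : Term n → Fin k → Formula n k
  ⊥̇   : Formula n k
  _⇒_ : Formula n k → Formula n k → Formula n k
  _∧_ : Formula n k → Formula n k → Formula n k
  _∨_ : Formula n k → Formula n k → Formula n k
  ∀₁  : Formula (suc n) k → Formula n k
  ∃₁  : Formula (suc n) k → Formula n k
  ∀₂  : Formula n (suc k) → Formula n k
  ∃₂  : Formula n (suc k) → Formula n k

Sentence : Set
Sentence = Formula 0 0

Theory : Set₁
Theory = Pred Sentence 0ℓ

private variable
  n m k l : ℕ

~_ : Formula n k → Formula n k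
~ φ = φ ⇒ ⊥̇

infix 6 ~_

_⇔_ : Formula n k → Formula n k → Formula n k
φ ⇔ ψ = (φ ⇒ ψ) ∧ (ψ ⇒ φ)

_[_]ᵗ : Term n → (Fin n → Term m) → Term m
var i   [ σ ]ᵗ = σ i
𝟎       [ σ ]ᵗ = 𝟎
𝟏       [ σ ]ᵗ = 𝟏
(s + t) [ σ ]ᵗ = s [ σ ]ᵗ + t [ σ ]ᵗ
(s · t) [ σ ]ᵗ = s [ σ ]ᵗ · t [ σ ]ᵗ

infix 8 _[_]ᵗ

wkᵗ : Term n → Term (suc n)
wkᵗ t = t [ var ∘ suc ]ᵗ

lift₁ : (Fin n → Term m) → Fin (suc n) → Term (suc m)
lift₁ σ = var zero Vector.∷ (wkᵗ ∘ σ)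

-- σ acts on number variables, ρ on set variables.
sub : (Fin n → Term m) → (Fin k → Fin l) → Formula n k → Formula m l
sub σ ρ (s ≐ t) = s [ σ ]ᵗ ≐ t [ σ ]ᵗ
sub σ ρ (s ⋖ t) = s [ σ ]ᵗ ⋖ t [ σ ]ᵗ
sub σ ρ (t ϵ X) = t [ σ ]ᵗ ϵ ρ X
sub σ ρ ⊥̇       = ⊥̇
sub σ ρ (φ ⇒ ψ) = sub σ ρ φ ⇒ sub σ ρ ψ
sub σ ρ (φ ∧ ψ) = sub σ ρ φ ∧ sub σ ρ ψ
sub σ ρ (φ ∨ ψ) = sub σ ρ φ ∨ sub σ ρ ψ
sub σ ρ (∀₁ φ)  = ∀₁ (sub (lift₁ σ) ρ φ)
sub σ ρ (∃₁ φ)  = ∃₁ (sub (lift₁ σ) ρ φ)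
sub σ ρ (∀₂ φ)  = ∀₂ (sub σ (lift 1 ρ) φ)
sub σ ρ (∃₂ φ)  = ∃₂ (sub σ (lift 1 ρ) φ)

wk₁ : Formula n k → Formula (suc n) k
wk₁ = sub (var ∘ suc) id

wk₂ : Formula n k → Formula n (suc k)
wk₂ = sub var suc

_[_]₁ : Formula (suc n) k → Term n → Formula n k
φ [ t ]₁ = sub (t Vector.∷ var) id φ

_[_]₂ : Formula n (suc k) → Fin k → Formula n k
φ [ X ]₂ = sub var (X Vector.∷ id) φ

infix 8 _[_]₁ _[_]₂

weakenSentence : Sentence → Formula n k
weakenSentence = sub (λ ()) (λ ())

∀-closure : ∀ n k → Formula n k → Sentence
∀-closure zero    zero    φ = φ
∀-closure zero    (suc k) φ = ∀-closure zero k (∀₂ φ)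
∀-closure (suc n) k       φ = ∀-closure n k (∀₁ φ)

-- Natural deduction for classical two-sorted first-order logic with
-- equality.  The free variables in scope are those of Formula n k; a
-- scope without set variables does not presuppose that sets exist, which
-- is immaterial for RCA₀ as comprehension proves that they do.

infix 0 _∣_⊢_ _⊢_

data _∣_⊢_ (T : Theory) : List (Formula n k) → Formula n k → Set where
  axiom : ∀ {Γ : List (Formula n k)} {φ} →
          T φ → T ∣ Γ ⊢ weakenSentence φ
  hyp   : ∀ {Γ : List (Formula n k)} {φ} → φ ∈ Γ → T ∣ Γ ⊢ φ
  raa   : ∀ {Γ : List (Formula n k)} {φ} →
          T ∣ ~ φ ∷ Γ ⊢ ⊥̇ → T ∣ Γ ⊢ φ
  ⇒I    : ∀ {Γ : List (Formula n k)} {φ ψ} →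
          T ∣ φ ∷ Γ ⊢ ψ → T ∣ Γ ⊢ φ ⇒ ψ
  ⇒E    : ∀ {Γ : List (Formula n k)} {φ ψ} →
          T ∣ Γ ⊢ φ ⇒ ψ → T ∣ Γ ⊢ φ → T ∣ Γ ⊢ ψ
  ∧I    : ∀ {Γ : List (Formula n k)} {φ ψ} →
          T ∣ Γ ⊢ φ → T ∣ Γ ⊢ ψ → T ∣ Γ ⊢ φ ∧ ψ
  ∧E₁   : ∀ {Γ : List (Formula n k)} {φ ψ} → T ∣ Γ ⊢ φ ∧ ψ → T ∣ Γ ⊢ φ
  ∧E₂   : ∀ {Γ : List (Formula n k)} {φ ψ} → T ∣ Γ ⊢ φ ∧ ψ → T ∣ Γ ⊢ ψ
  ∨I₁   : ∀ {Γ : List (Formula n k)} {φ ψ} → T ∣ Γ ⊢ φ → T ∣ Γ ⊢ φ ∨ ψ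
  ∨I₂   : ∀ {Γ : List (Formula n k)} {φ ψ} → T ∣ Γ ⊢ ψ → T ∣ Γ ⊢ φ ∨ ψ
  ∨E    : ∀ {Γ : List (Formula n k)} {φ ψ χ} →
          T ∣ Γ ⊢ φ ∨ ψ → T ∣ φ ∷ Γ ⊢ χ → T ∣ ψ ∷ Γ ⊢ χ → T ∣ Γ ⊢ χ
  ∀₁I   : ∀ {Γ : List (Formula n k)} {φ} →
          T ∣ map wk₁ Γ ⊢ φ → T ∣ Γ ⊢ ∀₁ φ
  ∀₁E   : ∀ {Γ : List (Formula n k)} {φ} →
          T ∣ Γ ⊢ ∀₁ φ → ∀ t → T ∣ Γ ⊢ φ [ t ]₁
  ∃₁I   : ∀ {Γ : List (Formula n k)} {φ} t →
          T ∣ Γ ⊢ φ [ t ]₁ → T ∣ Γ ⊢ ∃₁ φ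
  ∃₁E   : ∀ {Γ : List (Formula n k)} {φ χ} →
          T ∣ Γ ⊢ ∃₁ φ → T ∣ φ ∷ map wk₁ Γ ⊢ wk₁ χ → T ∣ Γ ⊢ χ
  ∀₂I   : ∀ {Γ : List (Formula n k)} {φ} →
          T ∣ map wk₂ Γ ⊢ φ → T ∣ Γ ⊢ ∀₂ φ
  ∀₂E   : ∀ {Γ : List (Formula n k)} {φ} →
          T ∣ Γ ⊢ ∀₂ φ → ∀ X → T ∣ Γ ⊢ φ [ X ]₂
  ∃₂I   : ∀ {Γ : List (Formula n k)} {φ} X →
          T ∣ Γ ⊢ φ [ X ]₂ → T ∣ Γ ⊢ ∃₂ φ
  ∃₂E   : ∀ {Γ : List (Formula n k)} {φ χ} →
          T ∣ Γ ⊢ ∃₂ φ → T ∣ φ ∷ map wk₂ Γ ⊢ wk₂ χ → T ∣ Γ ⊢ χ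
  ≐I    : ∀ {Γ : List (Formula n k)} t → T ∣ Γ ⊢ t ≐ t
  ≐E    : ∀ {Γ : List (Formula n k)} {s t} (φ : Formula (suc n) k) →
          T ∣ Γ ⊢ s ≐ t → T ∣ Γ ⊢ φ [ s ]₁ → T ∣ Γ ⊢ φ [ t ]₁

_⊢_ : Theory → Sentence → Set
T ⊢ φ = T ∣ [] ⊢ φ

-- Σ⁰₀: all quantifiers are number quantifiers bounded by a term in which
-- the quantified variable does not occur.  Set parameters are allowed.
data Σ⁰₀ {n k : ℕ} : Formula n k → Set where
  _≐_  : ∀ s t → Σ⁰₀ (s ≐ t)
  _⋖_  : ∀ s t → Σ⁰₀ (s ⋖ t)
  _ϵ_  : ∀ t X → Σ⁰₀ (t ϵ X)
  ⊥̇    : Σ⁰₀ ⊥̇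
  _⇒_  : ∀ {φ ψ} → Σ⁰₀ φ → Σ⁰₀ ψ → Σ⁰₀ (φ ⇒ ψ)
  _∧_  : ∀ {φ ψ} → Σ⁰₀ φ → Σ⁰₀ ψ → Σ⁰₀ (φ ∧ ψ)
  _∨_  : ∀ {φ ψ} → Σ⁰₀ φ → Σ⁰₀ ψ → Σ⁰₀ (φ ∨ ψ)
  ∀<   : ∀ t {φ} → Σ⁰₀ φ → Σ⁰₀ (∀₁ (var 0F ⋖ wkᵗ t ⇒ φ))
  ∃<   : ∀ t {φ} → Σ⁰₀ φ → Σ⁰₀ (∃₁ (var 0F ⋖ wkᵗ t ∧ φ))

data Σ⁰₁ {n k : ℕ} : Formula n k → Set where
  ∃₁ : ∀ {φ} → Σ⁰₀ φ → Σ⁰₁ (∃₁ φ)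

data Π⁰₁ {n k : ℕ} : Formula n k → Set where
  ∀₁ : ∀ {φ} → Σ⁰₀ φ → Π⁰₁ (∀₁ φ)

induction : Formula (suc n) k → Formula n k
induction φ =
  φ [ 𝟎 ]₁ ∧ ∀₁ (φ ⇒ sub ((var 0F + 𝟏) Vector.∷ (var ∘ suc)) id φ) ⇒ ∀₁ φ

-- The weakening wk₂ ensures that the comprehended set is not free in φ.
Δ-comprehension : Formula (suc n) k → Formula (suc n) k → Formula n k
Δ-comprehension φ ψ =
  ∀₁ (φ ⇔ ψ) ⇒ ∃₂ (∀₁ (var 0F ϵ 0F ⇔ wk₂ φ))

data RCA₀ : Theory where
  suc≢0    : RCA₀ (∀₁ (~ (var 0F + 𝟏 ≐ 𝟎)))
  suc-inj  : RCA₀ (∀₁ (∀₁ (var 1F + 𝟏 ≐ var 0F + 𝟏 ⇒ var 1F ≐ var 0F)))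
  +-zero   : RCA₀ (∀₁ (var 0F + 𝟎 ≐ var 0F))
  +-suc    : RCA₀ (∀₁ (∀₁ (var 1F + (var 0F + 𝟏) ≐ (var 1F + var 0F) + 𝟏)))
  ·-zero   : RCA₀ (∀₁ (var 0F · 𝟎 ≐ 𝟎))
  ·-suc    : RCA₀ (∀₁ (∀₁ (var 1F · (var 0F + 𝟏) ≐ var 1F · var 0F + var 1F)))
  ≮0       : RCA₀ (∀₁ (~ (var 0F ⋖ 𝟎)))
  <-suc    : RCA₀ (∀₁ (∀₁ (var 1F ⋖ var 0F + 𝟏
                             ⇔ (var 1F ⋖ var 0F ∨ var 1F ≐ var 0F))))
  Σ⁰₁-IND  : {φ : Formula (suc n) k} → Σ⁰₁ φ →
             RCA₀ (∀-closure n k (induction φ))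
  Δ⁰₁-CA   : {φ ψ : Formula (suc n) k} → Σ⁰₁ φ → Π⁰₁ ψ →
             RCA₀ (∀-closure n k (Δ-comprehension φ ψ))

-- The standard coding of pairs, (s , t) ↦ (s + t)² + s.
pair : Term n → Term n → Term n
pair s t = (s + t) · (s + t) + s

-- A set R codes the binary relation that holds of x and y iff
-- pair x y ϵ R; elements of R that are not pairs play no role.
_⟨_,_⟩ : Fin k → Term n → Term n → Formula n k
R ⟨ s , t ⟩ = pair s t ϵ R

infix 5 _⟨_,_⟩

IsReflexive IsIrreflexive IsAntisymmetric IsTransitive IsTrichotomous
  : Fin k → Formula n k
IsReflexive     R = ∀₁ (R ⟨ var 0F , var 0F ⟩)
IsIrreflexive   R = ∀₁ (~ (R ⟨ var 0F , var 0F ⟩))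
IsAntisymmetric R =
  ∀₁ (∀₁ (R ⟨ var 1F , var 0F ⟩ ⇒ R ⟨ var 0F , var 1F ⟩ ⇒ var 1F ≐ var 0F))
IsTransitive    R =
  ∀₁ (∀₁ (∀₁ (R ⟨ var 2F , var 1F ⟩ ⇒ R ⟨ var 1F , var 0F ⟩ ⇒
              R ⟨ var 2F , var 0F ⟩)))
IsTrichotomous  R =
  ∀₁ (∀₁ (R ⟨ var 1F , var 0F ⟩ ∨ var 1F ≐ var 0F ∨ R ⟨ var 0F , var 1F ⟩))

IsPoset IsStrictLinearOrder IsTournament : Fin k → Formula n k
IsPoset             R = IsReflexive R ∧ IsAntisymmetric R ∧ IsTransitive R
IsStrictLinearOrder R = IsIrreflexive R ∧ IsTransitive R ∧ IsTrichotomous R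
IsTournament        R =
  IsIrreflexive R ∧
  ∀₁ (∀₁ (~ (var 1F ≐ var 0F) ⇒
    (R ⟨ var 1F , var 0F ⟩ ∨ R ⟨ var 0F , var 1F ⟩) ∧
    ~ (R ⟨ var 1F , var 0F ⟩ ∧ R ⟨ var 0F , var 1F ⟩)))

-- F codes a function ℕ → ℕ: a set of pairs containing, for each x, exactly
-- one pair x y.
IsFunction : Fin k → Formula n k
IsFunction F =
  ∀₁ (var 0F ϵ F ⇒ ∃₁ (∃₁ (var 2F ≐ pair (var 1F) (var 0F)))) ∧
  ∀₁ (∃₁ (F ⟨ var 1F , var 0F ⟩ ∧
          ∀₁ (F ⟨ var 2F , var 0F ⟩ ⇒ var 0F ≐ var 1F)))

IsInfinite : Fin k → Formula n k
IsInfinite S = ∀₁ (∃₁ (var 1F ⋖ var 0F ∧ var 0F ϵ S))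

IsChain IsAntichain : Fin k → Fin k → Formula n k
IsChain     M S =
  ∀₁ (∀₁ (var 1F ϵ S ⇒ var 0F ϵ S ⇒
    M ⟨ var 1F , var 0F ⟩ ∨ M ⟨ var 0F , var 1F ⟩))
IsAntichain M S =
  ∀₁ (∀₁ (var 1F ϵ S ⇒ var 0F ϵ S ⇒ ~ (var 1F ≐ var 0F) ⇒
    ~ (M ⟨ var 1F , var 0F ⟩ ∨ M ⟨ var 0F , var 1F ⟩)))

CAC : Sentence
CAC = ∀₂ (IsPoset 0F ⇒
  ∃₂ (IsInfinite 0F ∧ (IsChain 1F 0F ∨ IsAntichain 1F 0F)))

-- x < y, F(x) = a and F(y) = b imply a <_L b, respectively b <_L a; the
-- variables x, y, a, b are var 3F, …, var 0F.
IsAscending IsDescending : Fin k → Fin k → Formula n k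
IsAscending  L F =
  ∀₁ (∀₁ (∀₁ (∀₁ (var 3F ⋖ var 2F ⇒
    F ⟨ var 3F , var 1F ⟩ ⇒ F ⟨ var 2F , var 0F ⟩ ⇒
    L ⟨ var 1F , var 0F ⟩))))
IsDescending L F =
  ∀₁ (∀₁ (∀₁ (∀₁ (var 3F ⋖ var 2F ⇒
    F ⟨ var 3F , var 1F ⟩ ⇒ F ⟨ var 2F , var 0F ⟩ ⇒
    L ⟨ var 0F , var 1F ⟩))))

ADS : Sentence
ADS = ∀₂ (IsStrictLinearOrder 0F ⇒
  ∃₂ (IsFunction 0F ∧ (IsAscending 1F 0F ∨ IsDescending 1F 0F)))

IsTransitiveOn : Fin k → Fin k → Formula n k
IsTransitiveOn T S =
  ∀₁ (∀₁ (∀₁ (var 2F ϵ S ⇒ var 1F ϵ S ⇒ var 0F ϵ S ⇒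
    T ⟨ var 2F , var 1F ⟩ ⇒ T ⟨ var 1F , var 0F ⟩ ⇒
    T ⟨ var 2F , var 0F ⟩)))

EM : Sentence
EM = ∀₂ (IsTournament 0F ⇒ ∃₂ (IsInfinite 0F ∧ IsTransitiveOn 1F 0F))

{-# OPTIONS --safe #-}
module Submission where

-- CAC and EM are separated by a property of oracles that survives the solution
-- of posets but excludes solutions of one fixed tournament.  Take a generic
-- stable tournament and let c say of each vertex x whether x → y or y → x for
-- almost all y.  Call c generic over X if every property of colourings that is
-- Σ₁ in X either holds of c or fails of all finite colourings far enough out.
-- Then no infinite set S computable in X is transitive: genericity yields an
-- edge a → b in S with b → y → a for almost all y.
--
-- Let P be a poset computable in X.  Mathias forcing builds an ascending set, an
-- antichain and a descending set side by side.  Given one Σ₁ requirement for each,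
-- ask whether they can be met by finite sets A, B, D in the reservoir with A below
-- B below D.  If they can be met with the colours of c, thin out the reservoir until
-- it decides the position of the elements of A, B and D; by transitivity one of the
-- three sets consists of elements of the right kind.  If not, then the attempt to
-- meet the requirements on successive windows of colours gets stuck, and one of
-- them has been bounded.  So c is generic over X together with a homogeneous set.
--
-- The oracles over which c is generic are the worlds of a forcing semantics, which
-- replaces the bookkeeping of an iteration.  As the metatheory is constructive,
-- truth is read through double negations, and generic sets are defined by always
-- moving to the least suitable condition.  In place of Turing functionals there is
-- a countable class of positive definitions, closed by fiat under the question above.

open import Data.Bool.Base using (Bool; true; false; T; if_then_else_)
open import Data.Bool.Properties using (T?)
open import Data.Empty using (⊥; ⊥-elim)
open import Data.Fin.Base as Fin using (Fin; zero; suc; toℕ)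
open import Data.List.Base using (List; []; _∷_; _++_; filter; map; tabulate)
open import Data.List.Membership.Propositional using (_∈_)
open import Data.List.Membership.Propositional.Properties
  using (∈-++⁺ˡ; ∈-++⁺ʳ; ∈-++⁻; ∈-filter⁺; ∈-filter⁻; ∈-map⁻)
open import Data.List.Relation.Unary.Any using (here; there)
open import Data.Nat.Base using (ℕ; zero; suc; _≤_; _<_; _⊔_; _∸_; z≤n; s≤s; s≤s⁻¹)
  renaming (_+_ to _+ℕ_; _*_ to _*ℕ_)
open import Data.Nat.Properties
open import Data.Product.Base using (∃; ∃-syntax; _×_; _,_; proj₁; proj₂)
open import Data.Sum.Base using (_⊎_; inj₁; inj₂)
open import Data.Unit.Base using (⊤; tt)
import Data.Vec.Functional as Vector
open import Function.Base using (_∘_; id; const; case_of_)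
open import Level using (Level; Lift; lift; lower)
open import Relation.Binary.Definitions using (tri<; tri≈; tri>)
open import Relation.Binary.PropositionalEquality
open import Relation.Nullary using (Dec; yes; no; does; contradiction)
open import Relation.Nullary.Decidable using (dec-true; dec-false; decidable-stable)
open import Relation.Nullary.Negation.Core using (¬_)
open import Relation.Unary using (_∪_; ｛_｝)
open import Defs

private variable
  ℓ : Level
  A B : Set ℓ

-- Double negation

return : A → ¬ ¬ A
return a k = k a

infixl 1 _>>=_
_>>=_ : ¬ ¬ A → (A → ¬ ¬ B) → ¬ ¬ B
(m >>= f) k = m λ a → f a k

lem : (A : Set ℓ) → ¬ ¬ (A ⊎ ¬ A)
lem A k = k (inj₂ λ a → k (inj₁ a))

¬¬-bounded : ∀ n {P : ℕ → Set ℓ} → (∀ z → z < n → ¬ ¬ P z) →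
             ¬ ¬ (∀ z → z < n → P z)
¬¬-bounded zero    f = return λ _ ()
¬¬-bounded (suc n) {P} f =
  ¬¬-bounded n (λ z z<n → f z (m≤n⇒m≤1+n z<n)) >>= λ g →
  f n ≤-refl >>= λ pn →
  return λ z z<1+n → case m≤n⇒m<n∨m≡n z<1+n of λ where
    (inj₁ (s≤s z<n)) → g z z<n
    (inj₂ refl) → pn

-- Pairing and countability

⌜_,_⌝ : ℕ → ℕ → ℕ
⌜ x , y ⌝ = (x +ℕ y) *ℕ (x +ℕ y) +ℕ x

private
  -- With `s = x + y` the code lies between `s²` and `s² + s`, which is less than `(s + 1)²`; so the
  -- code determines the sum.
  pair-sum-≮ : ∀ {x y x′ y′} → ⌜ x , y ⌝ ≡ ⌜ x′ , y′ ⌝ → ¬ (x +ℕ y < x′ +ℕ y′)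
  pair-sum-≮ {x} {y} {x′} {y′} eq lt = <-irrefl eq (begin-strict
    s *ℕ s +ℕ x           ≤⟨ +-monoʳ-≤ (s *ℕ s) (m≤m+n x y) ⟩
    s *ℕ s +ℕ s           ≡⟨ +-comm (s *ℕ s) s ⟩
    s +ℕ s *ℕ s           <⟨ s≤s (m≤n+m (s +ℕ s *ℕ s) s) ⟩
    suc (s +ℕ (s +ℕ s *ℕ s)) ≡⟨ cong (λ t → suc (s +ℕ t)) (sym (*-suc s s)) ⟩
    suc s *ℕ suc s        ≤⟨ *-mono-≤ lt lt ⟩
    s′ *ℕ s′              ≤⟨ m≤m+n (s′ *ℕ s′) x′ ⟩
    s′ *ℕ s′ +ℕ x′        ∎)
    where
    open ≤-Reasoning
    s = x +ℕ y
    s′ = x′ +ℕ y′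

pair-injective : ∀ {x y x′ y′} → ⌜ x , y ⌝ ≡ ⌜ x′ , y′ ⌝ → x ≡ x′ × y ≡ y′
pair-injective {x} {y} {x′} {y′} eq with <-cmp (x +ℕ y) (x′ +ℕ y′)
... | tri< lt _ _ = contradiction lt (pair-sum-≮ {x} {y} {x′} {y′} eq)
... | tri> _ _ gt = contradiction gt (pair-sum-≮ {x′} {y′} {x} {y} (sym eq))
... | tri≈ _ s≡s′ _ = x≡x′ , +-cancelˡ-≡ x y y′ (trans s≡s′ (cong (_+ℕ y′) (sym x≡x′)))
  where
  x≡x′ : x ≡ x′
  x≡x′ = +-cancelˡ-≡ ((x +ℕ y) *ℕ (x +ℕ y)) x x′
    (trans eq (cong (λ s → s *ℕ s +ℕ x′) (sym s≡s′)))

-- Puts the pairs with large second component beyond the height of a given piece, where its promised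
-- limits apply.
pair-≥ʳ : ∀ x y → y ≤ ⌜ x , y ⌝
pair-≥ʳ x y = ≤-trans (m≤n+m y x) (≤-trans (m≤m*m (x +ℕ y)) (m≤m+n _ x))
  where
  m≤m*m : ∀ m → m ≤ m *ℕ m
  m≤m*m zero    = z≤n
  m≤m*m (suc m) = m≤m+n (suc m) (m *ℕ suc m)

-- An intermediate type for coding: retractions into trees are written by structural recursion, and
-- arithmetic enters only through `encode`.
data Tree : Set where
  nil  : Tree
  node : ℕ → Tree → Tree → Tree

encode : Tree → ℕ
encode nil          = 0
encode (node n s t) = suc ⌜ n , ⌜ encode s , encode t ⌝ ⌝

encode-injective : ∀ {s t} → encode s ≡ encode t → s ≡ t
encode-injective {nil} {nil} _ = refl
encode-injective {node n s t} {node n′ s′ t′} eq =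
  case pair-injective {n} {⌜ encode s , encode t ⌝} {n′} {⌜ encode s′ , encode t′ ⌝}
         (suc-injective eq) of λ where
    (refl , eq′) → case pair-injective {encode s} {encode t} {encode s′} {encode t′} eq′ of λ
      (s≡s′ , t≡t′) → cong₂ (node n) (encode-injective s≡s′) (encode-injective t≡t′)

record Countable (A : Set ℓ) : Set ℓ where
  field
    toTree   : A → Tree
    fromTree : Tree → A
    retract  : ∀ a → fromTree (toTree a) ≡ a

  code : A → ℕ
  code a = encode (toTree a)

  code-injective : ∀ {a b} → code a ≡ code b → a ≡ b
  code-injective {a} {b} eq =
    trans (sym (retract a)) (trans (cong fromTree (encode-injective eq)) (retract b))

open Countable ⦃...⦄

instance
  ℕ-countable : Countable ℕ
  ℕ-countable .toTree n = node n nil nil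
  ℕ-countable .fromTree (node n _ _) = n
  ℕ-countable .fromTree nil = 0
  ℕ-countable .retract _ = refl

  ×-countable : ⦃ Countable A ⦄ → ⦃ Countable B ⦄ → Countable (A × B)
  ×-countable .toTree (a , b) = node 0 (toTree a) (toTree b)
  ×-countable .fromTree (node _ s t) = fromTree s , fromTree t
  ×-countable .fromTree nil = fromTree nil , fromTree nil
  ×-countable .retract (a , b) = cong₂ _,_ (retract a) (retract b)

  List-countable : ⦃ Countable A ⦄ → Countable (List A)
  List-countable {A = A} = record { toTree = to; fromTree = from; retract = retr }
    where
    to : List A → Tree
    to []       = nil
    to (x ∷ xs) = node 0 (toTree x) (to xs)
    from : Tree → List A
    from nil          = []
    from (node _ s t) = fromTree s ∷ from t
    retr : ∀ xs → from (to xs) ≡ xs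
    retr []       = refl
    retr (x ∷ xs) = cong₂ _∷_ (retract x) (retr xs)

-- Dependent choice, up to double negation, along a definable relation on a
-- countable type: from each state move to the successor of least code.
module Choice {C : Set} ⦃ _ : Countable C ⦄
  (Step : ℕ → C → C → Set) (step : ∀ s p → ¬ ¬ (∃ (Step s p))) (start : C) where

  IsLeast : (C → Set) → C → Set
  IsLeast P q = P q × (∀ r → P r → code q ≤ code r)

  -- If no element is least, then by induction on `n` no element of code below `n` satisfies `P`.
  least : (P : C → Set) → ¬ ¬ ∃ P → ¬ ¬ ∃ (IsLeast P)
  least P ex k = ex λ (q , Pq) → none (suc (code q)) q ≤-refl Pq
    where
    none : ∀ n q → code q < n → ¬ P q
    none (suc n) q (s≤s q≤n) Pq = k (q , Pq , λ r Pr →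
      ≮⇒≥ λ r<q → none n r (≤-trans r<q q≤n) Pr)

  Reach : ℕ → C → Set
  Reach zero    q = q ≡ start
  Reach (suc s) q = ∃[ p ] Reach s p × IsLeast (Step s p) q

  reach : ∀ s → ¬ ¬ ∃ (Reach s)
  reach zero    = return (start , refl)
  reach (suc s) =
    reach s >>= λ (p , r) →
    least (Step s p) (step s p) >>= λ (q , l) →
    return (q , p , r , l)

  -- Two least successors have equal codes, and `code` is injective. So the stages form one
  -- definable sequence although no state is computed.
  reach-unique : ∀ s {p q} → Reach s p → Reach s q → p ≡ q
  reach-unique zero    refl refl = refl
  reach-unique (suc s) (p , rp , Sp , lp) (q , rq , Sq , lq)
    with refl ← reach-unique s rp rq =
    code-injective (≤-antisym (lp _ Sq) (lq _ Sp))

  module _ (Inv : C → Set) (_⊴_ : C → C → Set) (⊴-refl : ∀ {p} → p ⊴ p)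
    (⊴-trans : ∀ {p q r} → p ⊴ q → q ⊴ r → p ⊴ r)
    (start-inv : Inv start)
    (step-inv : ∀ s {p q} → Inv p → Step s p q → Inv q × (p ⊴ q)) where

    reach-inv : ∀ s {p} → Reach s p → Inv p
    reach-inv zero    refl = start-inv
    reach-inv (suc s) (p , r , S , _) = proj₁ (step-inv s (reach-inv s r) S)

    reach-+ : ∀ d s {p q} → Reach s p → Reach (d +ℕ s) q → p ⊴ q
    reach-+ zero    s {p} rp rq = subst (p ⊴_) (reach-unique s rp rq) ⊴-refl
    reach-+ (suc d) s rp (p′ , r , S , _) =
      ⊴-trans (reach-+ d s rp r) (proj₂ (step-inv (d +ℕ s) (reach-inv (d +ℕ s) r) S))

    reach-≤ : ∀ {s t p q} → s ≤ t → Reach s p → Reach t q → p ⊴ q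
    reach-≤ {s} {t} {q = q} s≤t rp rq =
      reach-+ (t ∸ s) s rp (subst (λ u → Reach u q) (sym (m∸n+n≡m s≤t)) rq)

-- Partial oracles and positive definitions

infixr 5 _◂_
_◂_ : A → (ℕ → A) → ℕ → A
(a ◂ f) zero    = a
(a ◂ f) (suc i) = f i

-- A partial set decides some numbers positively and some negatively.
PSet : Set₁
PSet = Bool → ℕ → Set

Oracles : Set₁
Oracles = ℕ → PSet

infix 4 _⊑_
_⊑_ : PSet → PSet → Set
P ⊑ Q = ∀ b {z} → P b z → Q b z

infix 6 _↾_
_↾_ : PSet → ℕ → PSet
(P ↾ n) b z = z < n × P b z

⟪_,_⟫ : (ℕ → Set) → (ℕ → Set) → PSet
⟪ P , Q ⟫ true  = P
⟪ P , Q ⟫ false = Q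

total : (ℕ → Set) → PSet
total X = ⟪ X , ¬_ ∘ X ⟫

infix 4 _⊑*_
_⊑*_ : Oracles → Oracles → Set
O ⊑* O′ = ∀ i → O i ⊑ O′ i

-- The two features of enumeration operators: further information preserves a fact, and each fact
-- uses the oracles only below some number.
record Continuous (Φ : Oracles → Set) : Set₁ where
  field
    mono    : ∀ {O O′} → O ⊑* O′ → Φ O → Φ O′
    compact : ∀ {O} → Φ O → ∃[ n ] Φ (λ i → O i ↾ n)
open Continuous

↾-mono : ∀ {P m n} → m ≤ n → P ↾ m ⊑ P ↾ n
↾-mono m≤n b (z<m , p) = ≤-trans z<m m≤n , p

↾-⊑ : ∀ {P n} → P ↾ n ⊑ P
↾-⊑ b = proj₂

const-cont : {A : Set} → Continuous (const A)
const-cont .mono _ a = a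
const-cont .compact a = 0 , a

module _ {Φ Ψ : Oracles → Set} where

  ×-cont : Continuous Φ → Continuous Ψ → Continuous (λ O → Φ O × Ψ O)
  ×-cont f g .mono le (p , q) = f .mono le p , g .mono le q
  ×-cont f g .compact (p , q) with m , p′ ← f .compact p | n , q′ ← g .compact q =
    m ⊔ n , f .mono (λ i → ↾-mono (m≤m⊔n m n)) p′ , g .mono (λ i → ↾-mono (m≤n⊔m m n)) q′

  ⊎-cont : Continuous Φ → Continuous Ψ → Continuous (λ O → Φ O ⊎ Ψ O)
  ⊎-cont f g .mono le (inj₁ p) = inj₁ (f .mono le p)
  ⊎-cont f g .mono le (inj₂ q) = inj₂ (g .mono le q)
  ⊎-cont f g .compact (inj₁ p) with m , p′ ← f .compact p = m , inj₁ p′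
  ⊎-cont f g .compact (inj₂ q) with n , q′ ← g .compact q = n , inj₂ q′

Dec→-cont : ∀ {A : Set} {Φ} → Dec A → Continuous Φ → Continuous (λ O → A → Φ O)
Dec→-cont _ f .mono le p a = f .mono le (p a)
Dec→-cont (yes a) f .compact p with n , p′ ← f .compact (p a) = n , λ _ → p′
Dec→-cont (no ¬a) f .compact p = 0 , λ a → contradiction a ¬a

∃-cont : {A : Set} {Φ : A → Oracles → Set} → (∀ a → Continuous (Φ a)) →
         Continuous (λ O → ∃[ a ] Φ a O)
∃-cont f .mono le (a , p) = a , f a .mono le p
∃-cont f .compact (a , p) with n , p′ ← f a .compact p = n , a , p′

∀<-cont : ∀ k {Φ : ℕ → Oracles → Set} → (∀ z → Continuous (Φ z)) →
          Continuous (λ O → ∀ z → z < k → Φ z O)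
∀<-cont k f .mono le p z z<k = f z .mono le (p z z<k)
∀<-cont zero    f .compact p = 0 , λ _ ()
∀<-cont (suc k) f .compact p
  with m , p′ ← ∀<-cont k f .compact (λ z z<k → p z (m≤n⇒m≤1+n z<k))
     | n , q ← f k .compact (p k ≤-refl) =
  m ⊔ n , λ z z<1+k → case m≤n⇒m<n∨m≡n z<1+k of λ where
    (inj₁ (s≤s z<k)) → f z .mono (λ i → ↾-mono (m≤m⊔n m n)) (p′ z z<k)
    (inj₂ refl) → f k .mono (λ i → ↾-mono (m≤n⊔m m n)) q

∀∈-cont : ∀ {A : Set} (xs : List A) {Φ : A → Oracles → Set} → (∀ x → Continuous (Φ x)) →
          Continuous (λ O → ∀ x → x ∈ xs → Φ x O)
∀∈-cont xs f .mono le p x x∈ = f x .mono le (p x x∈)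
∀∈-cont []       f .compact p = 0 , λ _ ()
∀∈-cont (y ∷ xs) f .compact p
  with m , p′ ← ∀∈-cont xs f .compact (λ x x∈ → p x (there x∈))
     | n , q ← f y .compact (p y (here refl)) =
  m ⊔ n , λ where
    x (there x∈) → f x .mono (λ i → ↾-mono (m≤m⊔n m n)) (p′ x x∈)
    x (here refl) → f x .mono (λ i → ↾-mono (m≤n⊔m m n)) q

shift-cont : ∀ {Φ} → Continuous Φ → Continuous (λ O → Φ (O ∘ suc))
shift-cont f .mono le = f .mono (le ∘ suc)
shift-cont f .compact = f .compact

insert-cont : ∀ {Φ} Q → Continuous Φ → Continuous (λ O → Φ (O 0 ◂ Q ◂ O ∘ suc))
insert-cont Q f .mono le = f .mono λ where
  zero          → le 0
  (suc zero)    → λ _ q → q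
  (suc (suc i)) → le (suc i)
insert-cont Q f .compact p with n , p′ ← f .compact p =
  n , f .mono (λ where
    zero          → λ _ q → q
    (suc zero)    → ↾-⊑
    (suc (suc i)) → λ _ q → q) p′

atom-cont : ∀ i b z → Continuous (λ O → O i b z)
atom-cont i b z .mono le = le i b
atom-cont i b z .compact p = suc z , ≤-refl , p

-- For a total `P`, `n` is the number of elements below `a`. This serves to list a set in increasing
-- order.
Count : PSet → ℕ → ℕ → Set
Count P zero    n = n ≡ 0
Count P (suc a) n = (P true a × (∃[ m ] n ≡ suc m × Count P a m)) ⊎ (P false a × Count P a n)

count-cont : ∀ i a n → Continuous (λ O → Count (O i) a n)
count-cont i zero    n = const-cont
count-cont i (suc a) n = ⊎-cont
  (×-cont (atom-cont i true a) (∃-cont λ m → ×-cont const-cont (count-cont i a m)))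
  (×-cont (atom-cont i false a) (count-cont i a n))

-- The possible positions of x relative to y > x in a partial order; also the
-- kinds of homogeneous set: ascending, antichain, descending.
data Three : Set where
  ≺ ∥ ≻ : Three

_≟₃_ : (s t : Three) → Dec (s ≡ t)
≺ ≟₃ ≺ = yes refl
≺ ≟₃ ∥ = no λ ()
≺ ≟₃ ≻ = no λ ()
∥ ≟₃ ≺ = no λ ()
∥ ≟₃ ∥ = yes refl
∥ ≟₃ ≻ = no λ ()
≻ ≟₃ ≺ = no λ ()
≻ ≟₃ ∥ = no λ ()
≻ ≟₃ ≻ = yes refl

Col : PSet → Three → ℕ → ℕ → Set
Col P ≺ x y = P true ⌜ x , y ⌝
Col P ∥ x y = P false ⌜ x , y ⌝ × P false ⌜ y , x ⌝
Col P ≻ x y = P true ⌜ y , x ⌝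

-- New ascending elements are to lie below new antichain elements, and those
-- below new descending elements.
Cross : PSet → Three → Three → ℕ → ℕ → Set
Cross P ≺ ≺ x y = x < y → Col P ≺ x y
Cross P ∥ ∥ x y = x < y → Col P ∥ x y
Cross P ≻ ≻ x y = x < y → Col P ≻ x y
Cross P ≺ ∥ x y = P true ⌜ x , y ⌝
Cross P ≺ ≻ x y = P true ⌜ x , y ⌝
Cross P ∥ ≻ x y = P true ⌜ x , y ⌝
Cross P _ _ x y = ⊤

Labelled : Set
Labelled = List (ℕ × Three)

-- A Mathias condition: the elements put so far into the three homogeneous
-- sets, the reservoir, given by the position required relative to finitely
-- many elements, and a bound below which everything is decided.
record Cond : Set where
  constructor cond
  field
    elems : Labelled
    side  : Labelled
    bound : ℕ
open Cond

Reservoir : PSet → Cond → ℕ → Set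
Reservoir P p x = bound p ≤ x × (∀ m → m ∈ side p → Col P (proj₂ m) (proj₁ m) x)

Good : PSet → Cond → Labelled → Set
Good P p N =
  (∀ m → m ∈ N → Reservoir P p (proj₁ m)) ×
  (∀ m → m ∈ N → ∀ m′ → m′ ∈ N → Cross P (proj₂ m) (proj₂ m′) (proj₁ m) (proj₁ m′))

New : Three → Labelled → Set
New t N = ∃[ x ] (x , t) ∈ N

part : Three → Labelled → ℕ → Set
part t F z = (z , t) ∈ F

infixl 7 _·_
infixl 6 _+_

-- Codes of positive definitions

data Tm : Set where
  var     : ℕ → Tm
  𝟎 𝟏     : Tm
  _+_ _·_ : Tm → Tm → Tm

Env : Set
Env = ℕ → ℕ

prefix : List ℕ → Env → Env
prefix []       ρ = ρ
prefix (n ∷ ns) ρ = n ◂ prefix ns ρ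

⟦_⟧ : Tm → Env → ℕ
⟦ var i ⟧ ρ = ρ i
⟦ 𝟎 ⟧     ρ = 0
⟦ 𝟏 ⟧     ρ = 1
⟦ s + t ⟧ ρ = ⟦ s ⟧ ρ +ℕ ⟦ t ⟧ ρ
⟦ s · t ⟧ ρ = ⟦ s ⟧ ρ *ℕ ⟦ t ⟧ ρ

⌜_,_⌝ᵗ : Tm → Tm → Tm
⌜ s , t ⌝ᵗ = (s + t) · (s + t) + s

-- The counterpart of enumeration operators.  In hat, p and q define a poset and its
-- complement, the flags tell which of the three requirements are imposed, and
-- oracle 0 is the colouring.
data Code : Set where
  equal less : Tm → Tm → Code
  orc        : ℕ → Bool → Tm → Code
  and or     : Code → Code → Code
  some       : Code → Code
  some< all< : Tm → Code → Code
  call       : Code → Tm → Code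
  inst       : List ℕ → Code → Code
  shift      : Code → Code
  nonpair    : Tm → Code
  count      : Tm → Tm → Code
  hat        : (p q : Code) → Cond → (a₀ a₁ a₂ : Bool) → (e₀ e₁ e₂ : Code) → Code

-- `inst` supplies number parameters after the argument `ρ 0`, and `call` evaluates a code at a
-- single number. In the clause for `hat` the poset is read from `O ∘ suc` and so is independent of
-- the colouring; each part is inserted as oracle 1, cut off at a bound `ℓ` on the new elements.
Sat : Code → Oracles → Env → Set
Sat (equal s t)   O ρ = ⟦ s ⟧ ρ ≡ ⟦ t ⟧ ρ
Sat (less s t)    O ρ = ⟦ s ⟧ ρ < ⟦ t ⟧ ρ
Sat (orc i b t)   O ρ = O i b (⟦ t ⟧ ρ)
Sat (and e f)     O ρ = Sat e O ρ × Sat f O ρ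
Sat (or e f)      O ρ = Sat e O ρ ⊎ Sat f O ρ
Sat (some e)      O ρ = ∃[ z ] Sat e O (z ◂ ρ)
Sat (some< t e)   O ρ = ∃[ z ] z < ⟦ t ⟧ ρ × Sat e O (z ◂ ρ)
Sat (all< t e)    O ρ = ∀ z → z < ⟦ t ⟧ ρ → Sat e O (z ◂ ρ)
Sat (call e t)    O ρ = Sat e O (const (⟦ t ⟧ ρ))
Sat (inst ns e)   O ρ = Sat e O (ρ 0 ◂ prefix ns ρ)
Sat (shift e)     O ρ = Sat e (O ∘ suc) ρ
Sat (nonpair t)   O ρ = ∀ x y → ⟦ t ⟧ ρ ≢ ⌜ x , y ⌝
Sat (count s t)   O ρ = Count (O 0) (⟦ s ⟧ ρ) (⟦ t ⟧ ρ)
Sat (hat p q c a₀ a₁ a₂ e₀ e₁ e₂) O ρ =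
  ∃[ N ] ∃[ ℓ ] (∀ m → m ∈ N → proj₁ m < ℓ) ×
    Good ⟪ (λ z → Sat p (O ∘ suc) (const z)) , (λ z → Sat q (O ∘ suc) (const z)) ⟫ c N ×
    (T a₀ → New ≺ N × Sat e₀ (O 0 ◂ total (part ≺ (elems c ++ N)) ↾ ℓ ◂ O ∘ suc) ρ) ×
    (T a₁ → New ∥ N × Sat e₁ (O 0 ◂ total (part ∥ (elems c ++ N)) ↾ ℓ ◂ O ∘ suc) ρ) ×
    (T a₂ → New ≻ N × Sat e₂ (O 0 ◂ total (part ≻ (elems c ++ N)) ↾ ℓ ◂ O ∘ suc) ρ)

private
  col-cont : ∀ {P : Oracles → PSet} → (∀ b z → Continuous (λ O → P O b z)) →
             ∀ t x y → Continuous (λ O → Col (P O) t x y)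
  col-cont f ≺ x y = f true ⌜ x , y ⌝
  col-cont f ∥ x y = ×-cont (f false ⌜ x , y ⌝) (f false ⌜ y , x ⌝)
  col-cont f ≻ x y = f true ⌜ y , x ⌝

  cross-cont : ∀ {P : Oracles → PSet} → (∀ b z → Continuous (λ O → P O b z)) →
               ∀ s t x y → Continuous (λ O → Cross (P O) s t x y)
  cross-cont f ≺ ≺ x y = Dec→-cont (x <? y) (col-cont f ≺ x y)
  cross-cont f ∥ ∥ x y = Dec→-cont (x <? y) (col-cont f ∥ x y)
  cross-cont f ≻ ≻ x y = Dec→-cont (x <? y) (col-cont f ≻ x y)
  cross-cont f ≺ ∥ x y = f true ⌜ x , y ⌝
  cross-cont f ≺ ≻ x y = f true ⌜ x , y ⌝
  cross-cont f ∥ ≻ x y = f true ⌜ x , y ⌝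
  cross-cont f ∥ ≺ x y = const-cont
  cross-cont f ≻ ≺ x y = const-cont
  cross-cont f ≻ ∥ x y = const-cont

sat-cont : ∀ e ρ → Continuous (λ O → Sat e O ρ)
sat-cont (equal s t)   ρ = const-cont {⟦ s ⟧ ρ ≡ ⟦ t ⟧ ρ}
sat-cont (less s t)    ρ = const-cont {⟦ s ⟧ ρ < ⟦ t ⟧ ρ}
sat-cont (orc i b t)   ρ = atom-cont i b (⟦ t ⟧ ρ)
sat-cont (and e f)     ρ = ×-cont (sat-cont e ρ) (sat-cont f ρ)
sat-cont (or e f)      ρ = ⊎-cont (sat-cont e ρ) (sat-cont f ρ)
sat-cont (some e)      ρ = ∃-cont λ z → sat-cont e (z ◂ ρ)
sat-cont (some< t e)   ρ = ∃-cont λ z → ×-cont const-cont (sat-cont e (z ◂ ρ))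
sat-cont (all< t e)    ρ = ∀<-cont (⟦ t ⟧ ρ) λ z → sat-cont e (z ◂ ρ)
sat-cont (call e t)    ρ = sat-cont e (const (⟦ t ⟧ ρ))
sat-cont (inst ns e)   ρ = sat-cont e (ρ 0 ◂ prefix ns ρ)
sat-cont (shift e)     ρ = shift-cont (sat-cont e ρ)
sat-cont (nonpair t)   ρ = const-cont {∀ x y → ⟦ t ⟧ ρ ≢ ⌜ x , y ⌝}
sat-cont (count s t)   ρ = count-cont 0 (⟦ s ⟧ ρ) (⟦ t ⟧ ρ)
sat-cont (hat p q c a₀ a₁ a₂ e₀ e₁ e₂) ρ =
  ∃-cont λ N → ∃-cont λ ℓ → ×-cont const-cont (×-cont
    (×-cont
      (∀∈-cont N λ m → ×-cont const-cont
        (∀∈-cont (side c) λ m′ → col-cont pq (proj₂ m′) (proj₁ m′) (proj₁ m)))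
      (∀∈-cont N λ m → ∀∈-cont N λ m′ →
        cross-cont pq (proj₂ m) (proj₂ m′) (proj₁ m) (proj₁ m′)))
    (×-cont (Dec→-cont (T? a₀) (×-cont const-cont (insert-cont _ (sat-cont e₀ ρ))))
    (×-cont (Dec→-cont (T? a₁) (×-cont const-cont (insert-cont _ (sat-cont e₁ ρ))))
            (Dec→-cont (T? a₂) (×-cont const-cont (insert-cont _ (sat-cont e₂ ρ)))))))
  where
  pq : ∀ b z → Continuous λ O →
    ⟪ (λ z → Sat p (O ∘ suc) (const z)) , (λ z → Sat q (O ∘ suc) (const z)) ⟫ b z
  pq true  z = shift-cont (sat-cont p (const z))
  pq false z = shift-cont (sat-cont q (const z))

-- Countability of conditions and codes

instance
  Three-countable : Countable Three
  Three-countable .toTree ≺ = node 0 nil nil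
  Three-countable .toTree ∥ = node 1 nil nil
  Three-countable .toTree ≻ = node 2 nil nil
  Three-countable .fromTree (node 0 _ _) = ≺
  Three-countable .fromTree (node 1 _ _) = ∥
  Three-countable .fromTree _            = ≻
  Three-countable .retract ≺ = refl
  Three-countable .retract ∥ = refl
  Three-countable .retract ≻ = refl

  Bool-countable : Countable Bool
  Bool-countable .toTree true  = node 0 nil nil
  Bool-countable .toTree false = nil
  Bool-countable .fromTree (node _ _ _) = true
  Bool-countable .fromTree nil          = false
  Bool-countable .retract true  = refl
  Bool-countable .retract false = refl

  Cond-countable : Countable Cond
  Cond-countable .toTree (cond F σ ℓ) = toTree (F , σ , ℓ)
  Cond-countable .fromTree t = case fromTree t of λ (F , σ , ℓ) → cond F σ ℓ
  Cond-countable .retract (cond F σ ℓ) =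
    cong (λ (F , σ , ℓ) → cond F σ ℓ) (retract (F , σ , ℓ))

  Tm-countable : Countable Tm
  Tm-countable = record { toTree = to ; fromTree = from ; retract = retr }
    where
    to : Tm → Tree
    to (var i) = node 0 (toTree i) nil
    to 𝟎       = node 1 nil nil
    to 𝟏       = node 2 nil nil
    to (s + t) = node 3 (to s) (to t)
    to (s · t) = node 4 (to s) (to t)
    from : Tree → Tm
    from (node 0 i _) = var (fromTree i)
    from (node 1 _ _) = 𝟎
    from (node 2 _ _) = 𝟏
    from (node 3 s t) = from s + from t
    from (node 4 s t) = from s · from t
    from _            = 𝟎
    retr : ∀ t → from (to t) ≡ t
    retr (var i) = cong var (retract i)
    retr 𝟎       = refl
    retr 𝟏       = refl
    retr (s + t) = cong₂ _+_ (retr s) (retr t)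
    retr (s · t) = cong₂ _·_ (retr s) (retr t)

  Code-countable : Countable Code
  Code-countable = record { toTree = to ; fromTree = from ; retract = retr }
    where
    to : Code → Tree
    to (equal s t)    = node 0 (toTree s) (toTree t)
    to (less s t)    = node 1 (toTree s) (toTree t)
    to (orc i b t) = node 2 (toTree (i , b)) (toTree t)
    to (and e f)   = node 3 (to e) (to f)
    to (or e f)    = node 4 (to e) (to f)
    to (some e)      = node 5 (to e) nil
    to (some< t e)   = node 6 (toTree t) (to e)
    to (all< t e)  = node 7 (toTree t) (to e)
    to (call e t)  = node 8 (to e) (toTree t)
    to (shift e)   = node 9 (to e) nil
    to (nonpair t) = node 10 (toTree t) nil
    to (count s t) = node 11 (toTree s) (toTree t)
    to (inst ns e) = node 13 (toTree ns) (to e)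
    to (hat p q c a₀ a₁ a₂ e₀ e₁ e₂) =
      node 12 (toTree (c , a₀ , a₁ , a₂))
        (node 0 (node 0 (to p) (to q)) (node 0 (to e₀) (node 0 (to e₁) (to e₂))))
    from : Tree → Code
    from (node 0 s t)  = equal (fromTree s) (fromTree t)
    from (node 1 s t)  = less (fromTree s) (fromTree t)
    from (node 2 s t)  = case fromTree s of λ (i , b) → orc i b (fromTree t)
    from (node 3 s t)  = and (from s) (from t)
    from (node 4 s t)  = or (from s) (from t)
    from (node 5 s t)  = some (from s)
    from (node 6 s t)  = some< (fromTree s) (from t)
    from (node 7 s t)  = all< (fromTree s) (from t)
    from (node 8 s t)  = call (from s) (fromTree t)
    from (node 9 s t)  = shift (from s)
    from (node 10 s t) = nonpair (fromTree s)
    from (node 11 s t) = count (fromTree s) (fromTree t)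
    from (node 13 s t) = inst (fromTree s) (from t)
    from (node 12 s (node _ (node _ p q) (node _ e₀ (node _ e₁ e₂)))) =
      case fromTree s of λ (c , a₀ , a₁ , a₂) →
        hat (from p) (from q) c a₀ a₁ a₂ (from e₀) (from e₁) (from e₂)
    from _ = equal 𝟎 𝟎
    retr : ∀ e → from (to e) ≡ e
    retr (equal s t)    = cong₂ equal (retract s) (retract t)
    retr (less s t)    = cong₂ less (retract s) (retract t)
    retr (orc i b t) = cong₂ (λ (i , b) t → orc i b t) (retract (i , b)) (retract t)
    retr (and e f)   = cong₂ and (retr e) (retr f)
    retr (or e f)    = cong₂ or (retr e) (retr f)
    retr (some e)      = cong some (retr e)
    retr (some< t e)   = cong₂ some< (retract t) (retr e)
    retr (all< t e)  = cong₂ all< (retract t) (retr e)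
    retr (call e t)  = cong₂ call (retr e) (retract t)
    retr (shift e)   = cong shift (retr e)
    retr (nonpair t) = cong nonpair (retract t)
    retr (count s t) = cong₂ count (retract s) (retract t)
    retr (inst ns e) = cong₂ inst (retract ns) (retr e)
    retr (hat p q c a₀ a₁ a₂ e₀ e₁ e₂)
      rewrite retr p | retr q | retr e₀ | retr e₁ | retr e₂ =
      cong (λ (c , a₀ , a₁ , a₂) → hat p q c a₀ a₁ a₂ e₀ e₁ e₂) (retract (c , a₀ , a₁ , a₂))

-- Generic colourings and homogeneous sets for posets

totals : (ℕ → ℕ → Set) → Oracles
totals X i = total (X i)

-- Y is computable in the join of X 0, X 1, …, with codes for functionals.
infix 4 _≼_
record _≼_ (Y : ℕ → Set) (X : ℕ → ℕ → Set) : Set where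
  field
    pos neg   : Code
    pos-sound : ∀ {z} → Sat pos (totals X) (const z) → ¬ ¬ Y z
    neg-sound : ∀ {z} → Sat neg (totals X) (const z) → ¬ Y z
    decide    : ∀ z → ¬ ¬ (Sat pos (totals X) (const z) ⊎ Sat neg (totals X) (const z))

  pos-complete : ∀ {z} → Y z → ¬ ¬ Sat pos (totals X) (const z)
  pos-complete {z} y = decide z >>= λ where
    (inj₁ p) → return p
    (inj₂ n) → contradiction y (neg-sound n)

window : (ℕ → Bool) → ℕ → ℕ → PSet
window B n m b z = n ≤ z × z < m × B z ≡ b

-- The finite colourings in the second alternative say nothing about numbers below `n`. The code is
-- evaluated at 0, as a closed statement.
Generic : (ℕ → Set) → (ℕ → ℕ → Set) → Set
Generic c X = ∀ e → ¬ ¬ (Sat e (total c ◂ totals X) (const 0) ⊎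
  (∃[ n ] ∀ B m → ¬ Sat e (window B n m ◂ totals X) (const 0)))

sat-mono₂ : ∀ e {P P′ Q Q′ O ρ} → P ⊑ P′ → Q ⊑ Q′ →
            Sat e (P ◂ Q ◂ O) ρ → Sat e (P′ ◂ Q′ ◂ O) ρ
sat-mono₂ e P⊑ Q⊑ = sat-cont e _ .mono λ where
  zero          → P⊑
  (suc zero)    → Q⊑
  (suc (suc i)) → λ _ o → o

splice : ℕ → (ℕ → Bool) → (ℕ → Bool) → ℕ → Bool
splice m B B′ z = if does (z <? m) then B z else B′ z

window-spliceˡ : ∀ B B′ {n m k} → m ≤ k → window B n m ⊑ window (splice m B B′) n k
window-spliceˡ B B′ {m = m} m≤k b {z} (n≤z , z<m , Bz) =
  n≤z , ≤-trans z<m m≤k , trans (cong (λ d → if d then B z else B′ z) (dec-true (z <? m) z<m)) Bz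

window-spliceʳ : ∀ B B′ {n m k} → n ≤ m → window B′ m k ⊑ window (splice m B B′) n k
window-spliceʳ B B′ {m = m} n≤m b {z} (m≤z , z<k , Bz) =
  ≤-trans n≤m m≤z , z<k , trans (cong (λ d → if d then B z else B′ z) (dec-false (z <? m) (≤⇒≯ m≤z))) Bz

-- Mathias conditions and their extensions

module Extension {c X} (generic : Generic c X) (p⁺ p⁻ : Code) where

  P : PSet
  P = ⟪ (λ z → Sat p⁺ (totals X) (const z)) , (λ z → Sat p⁻ (totals X) (const z)) ⟫

  Infinite : Cond → Set
  Infinite p = ∀ n → ¬ ¬ (∃[ z ] n ≤ z × Reservoir P p z)

  -- By `kept`, reservoir elements stand in position `t` to each chosen element of kind `t`, and by
  -- `low` they exceed it; so adding one of them preserves `hom`.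
  record Valid (p : Cond) : Set where
    field
      infinite : Infinite p
      low      : ∀ m → m ∈ elems p → proj₁ m < bound p
      kept     : ∀ m → m ∈ elems p → m ∈ side p
      hom      : ∀ x y t → (x , t) ∈ elems p → (y , t) ∈ elems p → x < y → Col P t x y
  open Valid

  record Ext′ (New : ℕ × Three → Set) (p q : Cond) : Set where
    field
      bound≤ : bound p ≤ bound q
      side⊆  : ∀ m → m ∈ side p → m ∈ side q
      elems⊆ : ∀ m → m ∈ elems p → m ∈ elems q
      new    : ∀ m → m ∈ elems q → m ∈ elems p ⊎ (New m × Reservoir P p (proj₁ m))
  open Ext′

  Ext : Cond → Cond → Set
  Ext = Ext′ (const ⊤)

  ExtAt : Three → Cond → Cond → Set
  ExtAt t = Ext′ (λ m → proj₂ m ≡ t)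

  reservoir-⊆ : ∀ {New p q} → Ext′ New p q → ∀ {x} → Reservoir P q x → Reservoir P p x
  reservoir-⊆ e (b , r) = ≤-trans (bound≤ e) b , λ m m∈ → r m (side⊆ e m m∈)

  ext-refl : ∀ {p} → Ext p p
  ext-refl = record { bound≤ = ≤-refl ; side⊆ = λ _ → id ; elems⊆ = λ _ → id ; new = λ _ → inj₁ }

  ext-trans : ∀ {p q r} → Ext p q → Ext q r → Ext p r
  ext-trans e f = record
    { bound≤ = ≤-trans (bound≤ e) (bound≤ f)
    ; side⊆  = λ m → side⊆ f m ∘ side⊆ e m
    ; elems⊆ = λ m → elems⊆ f m ∘ elems⊆ e m
    ; new    = λ m m∈ → case new f m m∈ of λ where
        (inj₁ m∈q) → new e m m∈q
        (inj₂ (_ , r)) → inj₂ (tt , reservoir-⊆ e r)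
    }

  at⇒ext : ∀ {t p q} → ExtAt t p q → Ext p q
  at⇒ext e = record
    { bound≤ = bound≤ e ; side⊆ = side⊆ e ; elems⊆ = elems⊆ e
    ; new = λ m m∈ → case new e m m∈ of λ where
        (inj₁ m∈p) → inj₁ m∈p
        (inj₂ (_ , r)) → inj₂ (tt , r)
    }

  raise : ℕ → Cond → Cond
  raise k p = cond (elems p) (side p) (bound p ⊔ k)

  infinite-rebound : ∀ F σ ℓ ℓ′ → Infinite (cond F σ ℓ) → Infinite (cond F σ ℓ′)
  infinite-rebound F σ ℓ ℓ′ inf n = inf (n ⊔ ℓ′) >>= λ (z , n⊔ℓ′≤z , _ , r) →
    return (z , ≤-trans (m≤m⊔n n ℓ′) n⊔ℓ′≤z , ≤-trans (m≤n⊔m n ℓ′) n⊔ℓ′≤z , r)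

  raise-valid : ∀ k {p} → Valid p → Valid (raise k p)
  raise-valid k {p} v = record
    { infinite = infinite-rebound (elems p) (side p) (bound p) (bound p ⊔ k) (infinite v)
    ; low = λ m m∈ → ≤-trans (low v m m∈) (m≤m⊔n (bound p) k)
    ; kept = kept v
    ; hom = hom v
    }

  raise-ext : ∀ k {p} → Ext p (raise k p)
  raise-ext k {p} = record
    { bound≤ = m≤m⊔n (bound p) k ; side⊆ = λ _ → id ; elems⊆ = λ _ → id ; new = λ _ → inj₁ }

  -- Later elements come from the reservoir and are at least `bound p`, so membership below the
  -- bound is settled for good.
  info : Three → Cond → PSet
  info t p = total (part t (elems p)) ↾ bound p

  info-mono : ∀ {p q} t → Ext p q → info t p ⊑ info t q
  info-mono t e true  (z< , z∈) = ≤-trans z< (bound≤ e) , elems⊆ e _ z∈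
  info-mono t e false (z< , z∉) = ≤-trans z< (bound≤ e) , λ z∈ → case new e _ z∈ of λ where
    (inj₁ z∈p) → z∉ z∈p
    (inj₂ (_ , ℓ≤z , _)) → <⇒≱ z< ℓ≤z

  -- The condition forces the second alternative of `Generic` for the part of kind `t`.
  Bounded : Three → Code → Cond → Set
  Bounded t e p = ∃[ n ] ∀ r → Valid r → Ext p r → ∀ B m →
    ¬ Sat e (window B n m ◂ info t r ◂ totals X) (const 0)

  Handled : Three → Code → Cond → Set
  Handled t e p = Sat e (total c ◂ info t p ◂ totals X) (const 0) ⊎ Bounded t e p

  Success : Three → Code → ℕ → Cond → Set
  Success t e k q = (∃[ z ] k ≤ z × (z , t) ∈ elems q) × Handled t e q

  -- The element `x` can be added with kind `t` and leaves an infinite reservoir. Admitting every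
  -- `σ` that contains `side p` lets `alive-mono` pass from an extension back to the condition.
  Alive : Three → Cond → Set
  Alive t p = ∃[ x ] ∃[ σ ] (∀ m → m ∈ side p → m ∈ σ) × (x , t) ∈ σ ×
    Reservoir P p x × Infinite (cond (elems p) σ (bound p))

  Dense : Three → Cond → Set
  Dense t p = ∀ q → Ext p q → Valid q → ¬ ¬ Alive t q

  alive-mono : ∀ {t p q} → Ext p q → Alive t q → Alive t p
  alive-mono {p = p} {q} e (x , σ , ⊆σ , x∈ , r , inf) =
    x , σ , (λ m → ⊆σ m ∘ side⊆ e m) , x∈ , reservoir-⊆ e r ,
    infinite-rebound (elems q) σ (bound q) (bound p) inf

  alive-extend : ∀ {t p} → Valid p → Alive t p →
    ∃[ q ] ExtAt t p q × Valid q × (∃[ x ] (x , t) ∈ elems q × Reservoir P p x)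
  alive-extend {t} {p} v (x , σ , ⊆σ , x∈ , r , inf) =
    q , record
      { bound≤ = m≤m⊔n (bound p) (suc x)
      ; side⊆ = ⊆σ
      ; elems⊆ = λ _ → there
      ; new = λ where
          m (here refl) → inj₂ (refl , r)
          m (there m∈) → inj₁ m∈ } ,
    record
      { infinite = infinite-rebound (elems p) σ (bound p) (bound p ⊔ suc x) inf
      ; low = λ where
          m (here refl) → m≤n⊔m (bound p) (suc x)
          m (there m∈) → ≤-trans (low v m m∈) (m≤m⊔n (bound p) (suc x))
      ; kept = λ where
          m (here refl) → x∈
          m (there m∈) → ⊆σ m (kept v m m∈)
      ; hom = λ where
          y z s (here refl) (here refl) x<y → contradiction x<y (<-irrefl refl)
          y z s (here refl) (there z∈) x<y →
            contradiction x<y (≤⇒≯ (≤-trans (<⇒≤ (low v _ z∈)) (proj₁ r)))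
          y z s (there y∈) (here refl) x<y → proj₂ r _ (kept v _ y∈)
          y z s (there y∈) (there z∈) x<y → hom v y z s y∈ z∈ x<y } ,
    x , here refl , r
    where
    q : Cond
    q = cond ((x , t) ∷ elems p) σ (bound p ⊔ suc x)

  -- Turns an arbitrary extension into one that adds elements of kind `t` only, while keeping its
  -- reservoir and its information on that kind.
  restrict : Three → Cond → Cond → Cond
  restrict t p r =
    cond (elems p ++ filter (λ m → proj₂ m ≟₃ t) (elems r)) (side r) (bound r)

  module _ {t : Three} {p r : Cond} (e : Ext p r) (v : Valid r) where

    private
      ⊆r : ∀ m → m ∈ elems (restrict t p r) → m ∈ elems r
      ⊆r m m∈ = case ∈-++⁻ (elems p) m∈ of λ where
        (inj₁ m∈p) → elems⊆ e m m∈p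
        (inj₂ m∈f) → proj₁ (∈-filter⁻ (λ m → proj₂ m ≟₃ t) m∈f)

    restrict-ext : ExtAt t p (restrict t p r)
    restrict-ext = record
      { bound≤ = bound≤ e
      ; side⊆ = side⊆ e
      ; elems⊆ = λ _ → ∈-++⁺ˡ
      ; new = λ m m∈ → case ∈-++⁻ (elems p) m∈ of λ where
          (inj₁ m∈p) → inj₁ m∈p
          (inj₂ m∈f) → case ∈-filter⁻ (λ m → proj₂ m ≟₃ t) m∈f of λ
            (m∈r , m≡t) → case new e m m∈r of λ where
              (inj₁ m∈p) → inj₁ m∈p
              (inj₂ (_ , r)) → inj₂ (m≡t , r)
      }

    restrict-valid : Valid (restrict t p r)
    restrict-valid = record
      { infinite = infinite v
      ; low = λ m → low v m ∘ ⊆r m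
      ; kept = λ m → kept v m ∘ ⊆r m
      ; hom = λ x y s x∈ y∈ → hom v x y s (⊆r _ x∈) (⊆r _ y∈)
      }

    restrict-∈ : ∀ x → (x , t) ∈ elems r → (x , t) ∈ elems (restrict t p r)
    restrict-∈ x x∈ = ∈-++⁺ʳ (elems p) (∈-filter⁺ (λ m → proj₂ m ≟₃ t) x∈ refl)

    restrict-info : info t r ⊑ info t (restrict t p r)
    restrict-info true  (z< , z∈) = z< , restrict-∈ _ z∈
    restrict-info false (z< , z∉) = z< , z∉ ∘ ⊆r _

  -- By `restrict`, if no extension at kind `t` with a new element meets `e` on a window from `n`,
  -- then no extension of any sort with such an element does. Adding one element of kind `t` then
  -- makes `e` bounded.
  try : ∀ {t p} e n → Valid p → Dense t p → ¬ ¬ (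
    (∃[ q ] Ext p q × Valid q × (∃[ x ] (x , t) ∈ elems q × Reservoir P p x) × Bounded t e q) ⊎
    (∃[ r ] ExtAt t p r × Valid r × (∃[ x ] (x , t) ∈ elems r × Reservoir P p x) ×
      (∃[ B ] ∃[ m ] n ≤ m × Sat e (window B n m ◂ info t r ◂ totals X) (const 0))))
  try {t} {p} e n v dense = lem _ >>= λ where
    (inj₁ met) → return (inj₂ met)
    (inj₂ unmet) → dense p ext-refl v >>= λ alive →
      let q , at , vq , x , x∈ , rx = alive-extend v alive in
      return (inj₁ (q , at⇒ext at , vq , (x , x∈ , rx) , n , λ r vr er B m sat →
        let e′ = ext-trans (at⇒ext at) er in
        unmet (restrict t p r , restrict-ext e′ vr , restrict-valid e′ vr ,
            (x , restrict-∈ e′ vr x (elems⊆ er _ x∈) , rx) ,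
            -- The window is widened so as not to end before `n`; this only adds information.
            B , m ⊔ n , m≤n⊔m m n ,
            sat-mono₂ e (λ b (a , l , q) → a , ≤-trans l (m≤m⊔n m n) , q)
              (restrict-info e′ vr) sat)))

-- Meeting a requirement over a partial order

record IsOrder (P : PSet) : Set where
  field
    exclusive : ∀ {z} → P true z → P false z → ⊥
    decided   : ∀ z → ¬ ¬ (P true z ⊎ P false z)
    antisym   : ∀ {x y} → P true ⌜ x , y ⌝ → P true ⌜ y , x ⌝ → x ≡ y
    transit   : ∀ x y z → P true ⌜ x , y ⌝ → P true ⌜ y , z ⌝ → ¬ ¬ P true ⌜ x , z ⌝

module PosetExtension {c X} (generic : Generic c X) (p⁺ p⁻ : Code)
  (order : IsOrder (Extension.P generic p⁺ p⁻)) where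

  open Extension generic p⁺ p⁻
  open Valid
  open Ext′
  open IsOrder order

  col-total : ∀ x y → ¬ ¬ (∃[ t ] Col P t x y)
  col-total x y =
    decided ⌜ x , y ⌝ >>= λ where
      (inj₁ x≤y) → return (≺ , x≤y)
      (inj₂ x≰y) → decided ⌜ y , x ⌝ >>= λ where
        (inj₁ y≤x) → return (≻ , y≤x)
        (inj₂ y≰x) → return (∥ , x≰y , y≰x)

  -- Pigeonhole principle: the position relative to `x` splits the reservoir into three. Bounds
  -- `n₀`, `n₁`, `n₂` on all three would leave no element beyond their maximum.
  label : ∀ {F σ ℓ} → Infinite (cond F σ ℓ) → ∀ x →
          ¬ ¬ (∃[ t ] Infinite (cond F ((x , t) ∷ σ) ℓ))
  label {F} {σ} {ℓ} inf x k =
    k (≺ , λ n₀ none₀ → k (∥ , λ n₁ none₁ → k (≻ , λ n₂ none₂ →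
      inf (n₀ ⊔ (n₁ ⊔ n₂)) λ (z , n≤z , ℓ≤z , r) → col-total x z λ where
        (≺ , col) → none₀ (z , ≤-trans (m≤m⊔n n₀ _) n≤z , ℓ≤z , λ where
          m (here refl) → col
          m (there m∈) → r m m∈)
        (∥ , col) → none₁ (z , ≤-trans (m≤m⊔n n₁ n₂) (≤-trans (m≤n⊔m n₀ _) n≤z) , ℓ≤z , λ where
          m (here refl) → col
          m (there m∈) → r m m∈)
        (≻ , col) → none₂ (z , ≤-trans (m≤n⊔m n₁ n₂) (≤-trans (m≤n⊔m n₀ _) n≤z) , ℓ≤z , λ where
          m (here refl) → col
          m (there m∈) → r m m∈))))

  labels : ∀ {F σ ℓ} → Infinite (cond F σ ℓ) → (N : Labelled) →
    ¬ ¬ (∃[ σ′ ] (∀ m → m ∈ σ → m ∈ σ′) × Infinite (cond F σ′ ℓ) ×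
         (∀ m → m ∈ N → ∃[ s ] (proj₁ m , s) ∈ σ′))
  labels {σ = σ} inf [] = return (σ , (λ _ → id) , inf , λ _ ())
  labels {F} {ℓ = ℓ} inf ((x , _) ∷ N) =
    labels {F} {ℓ = ℓ} inf N >>= λ (σ′ , ⊆σ′ , inf′ , lab) →
    label {F} {σ′} {ℓ} inf′ x >>= λ (t , inf″) →
    return ((x , t) ∷ σ′ , (λ m → there ∘ ⊆σ′ m) , inf″ , λ where
      m (here refl) → t , here refl
      m (there m∈) → let s , s∈ = lab m m∈ in s , there s∈)

  some-alive : ∀ {p} → Valid p → ¬ ¬ (∃[ t ] Alive t p)
  some-alive {p} v =
    infinite v 0 >>= λ (x , _ , r) →
    label {elems p} (infinite v) x >>= λ (t , inf) →
    return (t , x , (x , t) ∷ side p , (λ _ → there) , here refl , r , inf)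

  -- A kind is alive in all valid extensions or dead for good; both persist, the latter by
  -- `alive-mono`.
  Status : Three → Cond → Set
  Status t p = Dense t p ⊎ ¬ Alive t p

  status-mono : ∀ {t p q} → Ext p q → Status t p → Status t q
  status-mono e (inj₁ dense) = inj₁ λ r er → dense r (ext-trans e er)
  status-mono e (inj₂ dead)  = inj₂ (dead ∘ alive-mono e)

  settle : ∀ t {p} → Valid p → ¬ ¬ (∃[ q ] Ext p q × Valid q × Status t q)
  settle t {p} v = lem (∃[ q ] Ext p q × Valid q × ¬ Alive t q) >>= λ where
    (inj₁ (q , e , vq , dead)) → return (q , e , vq , inj₂ dead)
    (inj₂ none) → return (p , ext-refl , v , inj₁ λ q e vq dead → none (q , e , vq , dead))

  active : ∀ {t p} → Status t p → Bool
  active (inj₁ _) = true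
  active (inj₂ _) = false

  alive⇒active : ∀ {t p} (s : Status t p) → Alive t p → T (active s)
  alive⇒active (inj₁ _)    _     = tt
  alive⇒active (inj₂ dead) alive = contradiction alive dead

  module _ (e : Three → Code) (k : ℕ) where

    Result : Cond → Set
    Result p = ∃[ q ] Ext p q × Valid q × (∃[ t ] Success t (e t) k q)

    module _ {p} (v : Valid p) (k≤ : k ≤ bound p) (status : ∀ t → Status t p)
      (fail : ¬ Result p) where

      -- The joint question put to `generic`. Requirements are imposed on the active kinds only,
      -- since `try` applies to those.
      ê : Code
      ê = hat p⁺ p⁻ p (active (status ≺)) (active (status ∥)) (active (status ≻))
                      (e ≺) (e ∥) (e ≻)

      module _ N ℓ (N<ℓ : ∀ m → m ∈ N → proj₁ m < ℓ) (good : Good P p N)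
        (reqs : ∀ t → T (active (status t)) → New t N ×
          Sat (e t) (total c ◂ total (part t (elems p ++ N)) ↾ ℓ ◂ totals X) (const 0))
        σ (⊆σ : ∀ m → m ∈ side p → m ∈ σ)
        (inf : Infinite (cond (elems p) σ (bound p ⊔ ℓ)))
        (lab : ∀ m → m ∈ N → ∃[ s ] (proj₁ m , s) ∈ σ) where

        private
          -- All elements of `N` of kind `t` are added at once. They are homogeneous among
          -- themselves by `Cross` and with the old ones by the reservoir, and their labels in `σ`
          -- give `kept`.
          succeed : ∀ t → T (active (status t)) → (∀ x → (x , t) ∈ N → (x , t) ∈ σ) → Result p
          succeed t a all with reqs t a
          ... | (x , x∈) , sat = q , ext , valid , t ,
            (x , ≤-trans k≤ (proj₁ (proj₁ good _ x∈)) ,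
              ∈-++⁺ʳ (elems p) (∈-filter⁺ (λ m → proj₂ m ≟₃ t) x∈ refl)) ,
            inj₁ (sat-mono₂ (e t) (λ _ → id) info⊑ sat)
            where
            Nₜ = filter (λ m → proj₂ m ≟₃ t) N
            q = cond (elems p ++ Nₜ) σ (bound p ⊔ ℓ)
            Nₜ⊆N : ∀ m → m ∈ Nₜ → m ∈ N × proj₂ m ≡ t
            Nₜ⊆N m = ∈-filter⁻ (λ m → proj₂ m ≟₃ t)
            ext : Ext p q
            ext = record
              { bound≤ = m≤m⊔n (bound p) ℓ
              ; side⊆ = ⊆σ
              ; elems⊆ = λ _ → ∈-++⁺ˡ
              ; new = λ m m∈ → case ∈-++⁻ (elems p) m∈ of λ where
                  (inj₁ m∈p) → inj₁ m∈p
                  (inj₂ m∈N) → inj₂ (tt , proj₁ good m (proj₁ (Nₜ⊆N m m∈N)))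
              }
            valid : Valid q
            valid = record
              { infinite = inf
              ; low = λ m m∈ → case ∈-++⁻ (elems p) m∈ of λ where
                  (inj₁ m∈p) → ≤-trans (low v m m∈p) (m≤m⊔n (bound p) ℓ)
                  (inj₂ m∈N) → ≤-trans (N<ℓ m (proj₁ (Nₜ⊆N m m∈N))) (m≤n⊔m (bound p) ℓ)
              ; kept = λ m m∈ → case ∈-++⁻ (elems p) m∈ of λ where
                  (inj₁ m∈p) → ⊆σ m (kept v m m∈p)
                  (inj₂ m∈N) → case Nₜ⊆N m m∈N of λ { (m∈ , refl) → all (proj₁ m) m∈ }
              ; hom = λ y z s y∈ z∈ y<z → case ∈-++⁻ (elems p) y∈ , ∈-++⁻ (elems p) z∈ of λ where
                  (inj₁ y∈p , inj₁ z∈p) → hom v y z s y∈p z∈p y<z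
                  (inj₁ y∈p , inj₂ z∈N) →
                    proj₂ (proj₁ good _ (proj₁ (Nₜ⊆N _ z∈N))) _ (kept v _ y∈p)
                  (inj₂ y∈N , inj₁ z∈p) → contradiction y<z
                    (<⇒≯ (≤-trans (low v _ z∈p) (proj₁ (proj₁ good _ (proj₁ (Nₜ⊆N _ y∈N))))))
                  (inj₂ y∈N , inj₂ z∈N) →
                    same s (proj₂ good _ (proj₁ (Nₜ⊆N _ y∈N)) _ (proj₁ (Nₜ⊆N _ z∈N))) y<z
              }
              where
              same : ∀ s {y z} → Cross P s s y z → y < z → Col P s y z
              same ≺ c = c
              same ∥ c = c
              same ≻ c = c
            info⊑ : total (part t (elems p ++ N)) ↾ ℓ ⊑ info t q
            info⊑ true (z< , z∈) = ≤-trans z< (m≤n⊔m (bound p) ℓ) ,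
              (case ∈-++⁻ (elems p) z∈ of λ where
                (inj₁ z∈p) → ∈-++⁺ˡ z∈p
                (inj₂ z∈N) → ∈-++⁺ʳ (elems p) (∈-filter⁺ (λ m → proj₂ m ≟₃ t) z∈N refl))
            info⊑ false (z< , z∉) = ≤-trans z< (m≤n⊔m (bound p) ℓ) , λ z∈ →
              case ∈-++⁻ (elems p) z∈ of λ where
                (inj₁ z∈p) → z∉ (∈-++⁺ˡ z∈p)
                (inj₂ z∈N) → z∉ (∈-++⁺ʳ (elems p) (proj₁ (Nₜ⊆N _ z∈N)))

          -- Otherwise `succeed` would contradict `fail`.
          misfit : ∀ t → T (active (status t)) →
                   ¬ ¬ (∃[ x ] ∃[ s ] (x , t) ∈ N × (x , s) ∈ σ × s ≢ t)
          misfit t a none = fail (succeed t a λ x x∈ → case lab _ x∈ of λ (s , s∈) →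
            case s ≟₃ t of λ where
              (yes refl) → s∈
              (no s≢t) → contradiction (x , s , x∈ , s∈ , s≢t) none)

          -- As `σ` leaves the reservoir infinite, `x` itself shows that its label is alive. So a
          -- misfit of one kind leads to a misfit of the kind that it is labelled with.
          label-active : ∀ {x t s} → (x , t) ∈ N → (x , s) ∈ σ → T (active (status s))
          label-active {x} {t} {s} x∈N x∈σ = alive⇒active (status s)
            (x , σ , ⊆σ , x∈σ , proj₁ good _ x∈N ,
             infinite-rebound (elems p) σ (bound p ⊔ ℓ) (bound p) inf)

          module _ z (ℓ≤z : ℓ ≤ z) (res : ∀ m → m ∈ σ → Col P (proj₂ m) (proj₁ m) z) where

            -- From `x ≤ y ≤ z` follows `x ≤ z`, and `z` lies beyond `N`; so the label of `x` could
            -- only be `≺`. The lemma `above` is the dual.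
            below : ∀ {x y t s} → P true ⌜ x , y ⌝ → (x , t) ∈ N → (x , s) ∈ σ → s ≢ ≺ →
                    (y , ≺) ∈ σ → ⊥
            below {x} {y} {s = s} x≤y x∈N x∈σ s≢≺ y∈σ =
              transit x y z x≤y (res _ y∈σ) λ x≤z → go s x≤z (res _ x∈σ) s≢≺
              where
              go : ∀ s → P true ⌜ x , z ⌝ → Col P s x z → s ≢ ≺ → ⊥
              go ≺ _   _       s≢≺ = s≢≺ refl
              go ∥ x≤z (n , _) _   = exclusive x≤z n
              go ≻ x≤z z≤x     _   =
                <⇒≢ (≤-trans (N<ℓ _ x∈N) ℓ≤z) (antisym x≤z z≤x)

            above : ∀ {x y t s} → P true ⌜ y , x ⌝ → (x , t) ∈ N → (x , s) ∈ σ → s ≢ ≻ →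
                    (y , ≻) ∈ σ → ⊥
            above {x} {y} {s = s} y≤x x∈N x∈σ s≢≻ y∈σ =
              transit z y x (res _ y∈σ) y≤x λ z≤x → go s z≤x (res _ x∈σ) s≢≻
              where
              go : ∀ s → P true ⌜ z , x ⌝ → Col P s x z → s ≢ ≻ → ⊥
              go ≻ _   _       s≢≻ = s≢≻ refl
              go ∥ z≤x (_ , n) _   = exclusive z≤x n
              go ≺ z≤x x≤z     _   =
                <⇒≢ (≤-trans (N<ℓ _ x∈N) ℓ≤z) (antisym x≤z z≤x)

            -- If a misfit `y` of kind `∥` has label `≺`, then kind `≺` is active and has a misfit
            -- as well; that one is below `y` by `Cross`, against `below`. Label `≻` is dual.
            absurd∥ : ¬ T (active (status ∥))
            absurd∥ a = misfit ∥ a λ where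
              (y , ∥ , y∈N , y∈σ , s≢∥) → s≢∥ refl
              (y , ≺ , y∈N , y∈σ , _) → misfit ≺ (label-active y∈N y∈σ)
                λ (x , s , x∈N , x∈σ , s≢≺) → below (proj₂ good _ x∈N _ y∈N) x∈N x∈σ s≢≺ y∈σ
              (y , ≻ , y∈N , y∈σ , _) → misfit ≻ (label-active y∈N y∈σ)
                λ (x , s , x∈N , x∈σ , s≢≻) → above (proj₂ good _ y∈N _ x∈N) x∈N x∈σ s≢≻ y∈σ

            -- Labels `∥` are excluded by `absurd∥`. There remain a misfit `x` of kind `≺` labelled
            -- `≻` and a misfit `y` of kind `≻` labelled `≺`; here `x` is below `y` by `Cross`,
            -- against `below`.
            absurd≺ : ¬ T (active (status ≺))
            absurd≺ a = misfit ≺ a λ where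
              (x , ≺ , x∈N , x∈σ , s≢≺) → s≢≺ refl
              (x , ∥ , x∈N , x∈σ , _) → absurd∥ (label-active x∈N x∈σ)
              (x , ≻ , x∈N , x∈σ , s≢≺) → misfit ≻ (label-active x∈N x∈σ) λ where
                (y , ≻ , y∈N , y∈σ , s≢≻) → s≢≻ refl
                (y , ∥ , y∈N , y∈σ , _) → absurd∥ (label-active y∈N y∈σ)
                (y , ≺ , y∈N , y∈σ , _) →
                  below (proj₂ good _ x∈N _ y∈N) x∈N x∈σ s≢≺ y∈σ

            absurd : ∀ t → ¬ T (active (status t))
            absurd ≺ = absurd≺
            absurd ∥ = absurd∥
            absurd ≻ a = misfit ≻ a λ where
              (y , ≻ , y∈N , y∈σ , s≢≻) → s≢≻ refl
              (y , ∥ , y∈N , y∈σ , _) → absurd∥ (label-active y∈N y∈σ)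
              (y , ≺ , y∈N , y∈σ , _) → absurd≺ (label-active y∈N y∈σ)

        found-labelled : ⊥
        found-labelled =
          inf ℓ λ (z , ℓ≤z , _ , res) → some-alive v λ (t , alive) →
          absurd z ℓ≤z res t (alive⇒active (status t) alive)

      found : ¬ Sat ê (total c ◂ totals X) (const 0)
      found (N , ℓ , N<ℓ , good , r₀ , r₁ , r₂) =
        labels {elems p} (infinite-rebound (elems p) (side p) (bound p) (bound p ⊔ ℓ) (infinite v)) N
          λ (σ , ⊆σ , inf , lab) → found-labelled N ℓ N<ℓ good reqs σ ⊆σ inf lab
        where
        reqs : ∀ t → T (active (status t)) → New t N ×
          Sat (e t) (total c ◂ total (part t (elems p ++ N)) ↾ ℓ ◂ totals X) (const 0)
        reqs ≺ = r₀
        reqs ∥ = r₁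
        reqs ≻ = r₂

      attempt : ∀ t (s : Status t p) n {q} → Ext p q → Valid q →
        ¬ ¬ (∃[ r ] ∃[ B ] ∃[ m ] ExtAt t q r × Valid r × n ≤ m × (T (active s) →
          (∃[ x ] (x , t) ∈ elems r × Reservoir P q x) ×
          Sat (e t) (window B n m ◂ info t r ◂ totals X) (const 0)))
      attempt t (inj₂ _) n {q} ex vq =
        return (q , const true , n ,
          record { bound≤ = ≤-refl ; side⊆ = λ _ → id ; elems⊆ = λ _ → id ; new = λ _ → inj₁ } ,
          vq , ≤-refl , λ ())
      attempt t (inj₁ dense) n ex vq =
        try (e t) n vq (λ r er → dense r (ext-trans ex er)) >>= λ where
          (inj₁ (q , eq , vq′ , (x , x∈ , rx) , bd)) _ →
            fail (q , ext-trans ex eq , vq′ , t ,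
              (x , ≤-trans k≤ (≤-trans (bound≤ ex) (proj₁ rx)) , x∈) , inj₂ bd)
          (inj₂ (r , er , vr , el , B , m , n≤m , sat)) →
            return (r , B , m , er , vr , n≤m , λ _ → el , sat)

      -- If every active part could be met on a window, then three successive
      -- windows together would satisfy ê.
      unbounded : ∀ n → ¬ (∀ B m → ¬ Sat ê (window B n m ◂ totals X) (const 0))
      unbounded n none =
        -- The order of the kinds yields `Cross`: descending elements are chosen in a reservoir
        -- above the ascending ones, and the antichain last, in a reservoir above the ascending and
        -- below the descending ones.
        attempt ≺ (status ≺) n ext-refl v λ (q₁ , B₁ , m₁ , a₁ , v₁ , n≤m₁ , r₁) →
        let x₁ = at⇒ext a₁ in
        attempt ≻ (status ≻) m₁ x₁ v₁ λ (q₂ , B₂ , m₂ , a₂ , v₂ , m₁≤m₂ , r₂) →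
        let x₂ = at⇒ext a₂ in
        attempt ∥ (status ∥) m₂ (ext-trans x₁ x₂) v₂ λ (q₃ , B₃ , m₃ , a₃ , v₃ , m₂≤m₃ , r₃) →
        let
          x₃ = at⇒ext a₃
          ex = ext-trans x₁ (ext-trans x₂ x₃)
          fresh? : ∀ (m : ℕ × Three) → Dec (bound p ≤ proj₁ m)
          fresh? = λ m → bound p ≤? proj₁ m
          -- Elements of `p` lie below `bound p` and added ones do not, so the bound tells them
          -- apart.
          N = filter fresh? (elems q₃)

          N⊆ : ∀ m → m ∈ N → m ∈ elems q₃ × bound p ≤ proj₁ m
          N⊆ = λ m → ∈-filter⁻ fresh?

          old : ∀ m → m ∈ N → ¬ (m ∈ elems p)
          old = λ m m∈N m∈p → <⇒≱ (low v m m∈p) (proj₂ (N⊆ m m∈N))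

          res : ∀ m → m ∈ N → Reservoir P p (proj₁ m)
          res = λ m m∈N → case new ex m (proj₁ (N⊆ m m∈N)) of λ where
            (inj₁ m∈p) → contradiction m∈p (old m m∈N)
            (inj₂ (_ , r)) → r

          ≺-in : ∀ x → (x , ≺) ∈ N → (x , ≺) ∈ side q₁
          ≺-in = λ x x∈N → case new a₃ _ (proj₁ (N⊆ _ x∈N)) of λ where
            (inj₂ (() , _))
            (inj₁ x∈q₂) → case new a₂ _ x∈q₂ of λ where
              (inj₂ (() , _))
              (inj₁ x∈q₁) → kept v₁ _ x∈q₁

          ≻-in : ∀ x → (x , ≻) ∈ N → (x , ≻) ∈ side q₂ × Reservoir P q₁ x
          ≻-in = λ x x∈N → case new a₃ _ (proj₁ (N⊆ _ x∈N)) of λ where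
            (inj₂ (() , _))
            (inj₁ x∈q₂) → case new a₂ _ x∈q₂ of λ where
              (inj₂ (_ , r)) → kept v₂ _ x∈q₂ , r
              (inj₁ x∈q₁) → case new a₁ _ x∈q₁ of λ where
                (inj₂ (() , _))
                (inj₁ x∈p) → contradiction x∈p (old _ x∈N)

          ∥-in : ∀ x → (x , ∥) ∈ N → Reservoir P q₂ x
          ∥-in = λ x x∈N → case new a₃ _ (proj₁ (N⊆ _ x∈N)) of λ where
            (inj₂ (_ , r)) → r
            (inj₁ x∈q₂) → case new a₂ _ x∈q₂ of λ where
              (inj₂ (() , _))
              (inj₁ x∈q₁) → case new a₁ _ x∈q₁ of λ where
                (inj₂ (() , _))
                (inj₁ x∈p) → contradiction x∈p (old _ x∈N)

          cross : ∀ m → m ∈ N → ∀ m′ → m′ ∈ N → Cross P (proj₂ m) (proj₂ m′) (proj₁ m) (proj₁ m′)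
          cross = λ where
            (x , ≺) x∈ (y , ≺) y∈ → hom v₃ x y ≺ (proj₁ (N⊆ _ x∈)) (proj₁ (N⊆ _ y∈))
            (x , ≺) x∈ (y , ∥) y∈ → proj₂ (reservoir-⊆ x₂ (∥-in y y∈)) _ (≺-in x x∈)
            (x , ≺) x∈ (y , ≻) y∈ → proj₂ (proj₂ (≻-in y y∈)) _ (≺-in x x∈)
            (x , ∥) x∈ (y , ≺) y∈ → tt
            (x , ∥) x∈ (y , ∥) y∈ → hom v₃ x y ∥ (proj₁ (N⊆ _ x∈)) (proj₁ (N⊆ _ y∈))
            (x , ∥) x∈ (y , ≻) y∈ → proj₂ (∥-in x x∈) _ (proj₁ (≻-in y y∈))
            (x , ≻) x∈ (y , ≺) y∈ → tt
            (x , ≻) x∈ (y , ∥) y∈ → tt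
            (x , ≻) x∈ (y , ≻) y∈ → hom v₃ x y ≻ (proj₁ (N⊆ _ x∈)) (proj₁ (N⊆ _ y∈))

          -- The colours are `B₁` up to `m₁`, `B₂` up to `m₂` and `B₃` from there on, so the joint
          -- colouring extends each of the three windows.
          B₂₃ = splice m₂ B₂ B₃
          B = splice m₁ B₁ B₂₃

          info⊑ : ∀ t {q} → Ext q q₃ → info t q ⊑ total (part t (elems p ++ N)) ↾ bound q₃
          info⊑ = λ t eq → λ where
            true z → case info-mono t eq true z of λ (z< , z∈) →
              z< , (case bound p ≤? _ of λ where
                (yes ℓ≤z) → ∈-++⁺ʳ (elems p) (∈-filter⁺ fresh? z∈ ℓ≤z)
                (no ℓ≰z) → case new ex _ z∈ of λ where
                  (inj₁ z∈p) → ∈-++⁺ˡ z∈p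
                  (inj₂ (_ , ℓ≤z , _)) → contradiction ℓ≤z ℓ≰z)
            false z → case info-mono t eq false z of λ (z< , z∉) →
              z< , λ z∈ → case ∈-++⁻ (elems p) z∈ of λ where
                (inj₁ z∈p) → z∉ (elems⊆ ex _ z∈p)
                (inj₂ z∈N) → z∉ (proj₁ (N⊆ _ z∈N))
        in none B m₃ (N , bound q₃ , (λ m → low v₃ m ∘ proj₁ ∘ N⊆ m) , (res , cross) ,
          (λ a → let ((x , x∈ , r) , sat) = r₁ a in
            (x , ∈-filter⁺ fresh? (elems⊆ (ext-trans x₂ x₃) _ x∈) (proj₁ r)) ,
            sat-mono₂ (e ≺) (window-spliceˡ B₁ B₂₃ (≤-trans m₁≤m₂ m₂≤m₃))
              (info⊑ ≺ (ext-trans x₂ x₃)) sat) ,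
          (λ a → let ((x , x∈ , r) , sat) = r₃ a in
            (x , ∈-filter⁺ fresh? x∈ (proj₁ (reservoir-⊆ (ext-trans x₁ x₂) r))) ,
            sat-mono₂ (e ∥) (λ b → window-spliceʳ B₁ B₂₃ n≤m₁ b ∘ window-spliceʳ B₂ B₃ m₁≤m₂ b)
              (info⊑ ∥ ext-refl) sat) ,
          (λ a → let ((x , x∈ , r) , sat) = r₂ a in
            (x , ∈-filter⁺ fresh? (elems⊆ x₃ _ x∈) (proj₁ (reservoir-⊆ x₁ r))) ,
            sat-mono₂ (e ≻) (λ b → window-spliceʳ B₁ B₂₃ n≤m₁ b ∘ window-spliceˡ B₂ B₃ m₂≤m₃ b)
              (info⊑ ≻ x₃) sat))

      impossible : ⊥
      impossible = generic ê λ where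
        (inj₁ sat) → found sat
        (inj₂ (n , none)) → unbounded n none

    -- First the bound is raised to make all new elements at least `k`. Then the kinds are settled
    -- in turn, each status surviving the later extensions.
    progress : ∀ {p} → Valid p → ¬ ¬ Result p
    progress {p} v fail =
      settle ≺ (raise-valid k v) λ (q₁ , e₁ , v₁ , s₁) →
      settle ∥ v₁ λ (q₂ , e₂ , v₂ , s₂) →
      settle ≻ v₂ λ (q₃ , e₃ , v₃ , s₃) →
      let ex = ext-trans (raise-ext k) (ext-trans e₁ (ext-trans e₂ e₃)) in
      impossible v₃
        (≤-trans (m≤n⊔m (bound p) k)
          (≤-trans (bound≤ e₁) (≤-trans (bound≤ e₂) (bound≤ e₃))))
        (λ where
          ≺ → status-mono (ext-trans e₂ e₃) s₁
          ∥ → status-mono e₃ s₂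
          ≻ → s₃)
        λ (q , eq , vq , t , s) → fail (q , ext-trans ex eq , vq , t , s)

-- The generic homogeneous set

module HomogeneousSet {c X} (generic : Generic c X) (p⁺ p⁻ : Code)
  (order : IsOrder (Extension.P generic p⁺ p⁻)) where

  open Extension generic p⁺ p⁻
  open PosetExtension generic p⁺ p⁻ order
  open Valid
  open Ext′

  Requirement : Set
  Requirement = Code × Code × Code × ℕ

  demand : Requirement → Three → Code
  demand (e₀ , e₁ , e₂ , _) ≺ = e₀
  demand (e₀ , e₁ , e₂ , _) ∥ = e₁
  demand (e₀ , e₁ , e₂ , _) ≻ = e₂

  size : Requirement → ℕ
  size (_ , _ , _ , k) = k

  -- Stage `s` treats the requirement of code `s`, if there is one. With `Valid p` as a hypothesis
  -- every state has a successor, as `Choice` demands.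
  Step : ℕ → Cond → Cond → Set
  Step s p q = Valid p → (Valid q × Ext p q) ×
    (∀ r → code r ≡ s → ∃[ t ] Success t (demand r t) (size r) q)

  step : ∀ s p → ¬ ¬ (∃ (Step s p))
  step s p = lem (Valid p) >>= λ where
    (inj₂ ¬v) → return (p , λ v → contradiction v ¬v)
    (inj₁ v) → lem (∃[ r ] code r ≡ s) >>= λ where
      (inj₂ none) → return (p , λ _ → (v , ext-refl) , λ r r≡s → contradiction (r , r≡s) none)
      (inj₁ (r , refl)) → progress (demand r) (size r) v >>= λ (q , ex , vq , t , suc-t) →
        return (q , λ _ → (vq , ex) , λ r′ r′≡r →
          t , subst (λ r → Success t (demand r t) (size r) q) (sym (code-injective r′≡r)) suc-t)

  start : Cond
  start = cond [] [] 0

  start-valid : Valid start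
  start-valid = record
    { infinite = λ n → return (n , ≤-refl , z≤n , λ _ ())
    ; low = λ _ () ; kept = λ _ () ; hom = λ _ _ _ () }

  open Choice Step step start

  valid : ∀ s {p} → Reach s p → Valid p
  valid = reach-inv Valid Ext ext-refl ext-trans start-valid λ s v S → proj₁ (S v)

  extends : ∀ {s t p q} → s ≤ t → Reach s p → Reach t q → Ext p q
  extends = reach-≤ Valid Ext ext-refl ext-trans start-valid λ s v S → proj₁ (S v)

  G : Three → ℕ → Set
  G t z = ∃[ s ] ∃[ p ] Reach s p × (z , t) ∈ elems p

  G-hom : ∀ {t x y} → G t x → G t y → x < y → Col P t x y
  G-hom {t} {x} {y} (s , p , rp , x∈) (s′ , q , rq , y∈) x<y = case ≤-total s s′ of λ where
    (inj₁ s≤s′) → hom (valid s′ rq) x y t (elems⊆ (extends s≤s′ rp rq) _ x∈) y∈ x<y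
    (inj₂ s′≤s) → hom (valid s rp) x y t x∈ (elems⊆ (extends s′≤s rq rp) _ y∈) x<y

  info⊑G : ∀ {s p} t → Reach s p → info t p ⊑ total (G t)
  info⊑G {s} {p} t rp true  (_ , z∈) = s , p , rp , z∈
  info⊑G {s} {p} t rp false (z< , z∉) (s′ , q , rq , z∈) = case ≤-total s s′ of λ where
    (inj₁ s≤s′) → case new (extends s≤s′ rp rq) _ z∈ of λ where
      (inj₁ z∈p) → z∉ z∈p
      (inj₂ (_ , ℓ≤z , _)) → <⇒≱ z< ℓ≤z
    (inj₂ s′≤s) → z∉ (elems⊆ (extends s′≤s rq rp) _ z∈)

  -- Each of the finitely many elements of `G t` below `n` enters at some stage, and a later stage
  -- contains them all.
  settled : ∀ t s n → ¬ ¬ (∃[ s′ ] ∃[ p ] s ≤ s′ × Reach s′ p ×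
            (∀ z → z < n → G t z → (z , t) ∈ elems p))
  settled t s zero = reach s >>= λ (p , rp) → return (s , p , ≤-refl , rp , λ _ ())
  settled t s (suc n) =
    settled t s n >>= λ (s₁ , p₁ , s≤s₁ , r₁ , all) →
    lem (G t n) >>= λ where
      (inj₂ n∉) → return (s₁ , p₁ , s≤s₁ , r₁ , λ z z< z∈ → case m≤n⇒m<n∨m≡n z< of λ where
        (inj₁ (s≤s z<n)) → all z z<n z∈
        (inj₂ refl) → contradiction z∈ n∉)
      (inj₁ (s₂ , p₂ , r₂ , n∈)) →
        reach (s₁ ⊔ s₂) >>= λ (p₃ , r₃) →
        return (s₁ ⊔ s₂ , p₃ , ≤-trans s≤s₁ (m≤m⊔n s₁ s₂) , r₃ , λ z z< z∈ →
          case m≤n⇒m<n∨m≡n z< of λ where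
            (inj₁ (s≤s z<n)) → elems⊆ (extends (m≤m⊔n s₁ s₂) r₁ r₃) _ (all z z<n z∈)
            (inj₂ refl) → elems⊆ (extends (m≤n⊔m s₁ s₂) r₂ r₃) _ n∈)

  Met Missed : Three → Code → Set
  Met t e = Sat e (total c ◂ total (G t) ◂ totals X) (const 0)
  Missed t e = ∃[ n ] ∀ B m → ¬ Sat e (window B n m ◂ total (G t) ◂ totals X) (const 0)

  -- In the bounded case, a satisfied instance uses `G t` only below some `N`. A late stage with its
  -- bound raised to `N` contains that information and extends `p`, a contradiction.
  handled : ∀ {s p} t e → Reach s p → Handled t e p → Met t e ⊎ Missed t e
  handled t e rp (inj₁ sat) = inj₁ (sat-mono₂ e (λ _ → id) (info⊑G t rp) sat)
  handled {s} {p} t e rp (inj₂ (n , none)) = inj₂ (n , λ B m sat →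
    case sat-cont e (const 0) .compact sat of λ (N , sat′) →
    settled t s N λ (s′ , q , s≤s′ , rq , all) →
    none (raise N q) (raise-valid N (valid s′ rq))
      (ext-trans (extends s≤s′ rp rq) (raise-ext N)) B m
      (sat-cont e (const 0) .mono
        (λ where
          zero          → ↾-⊑
          (suc zero) true  (z<N , z∈) → ≤-trans z<N (m≤n⊔m (bound q) N) , all _ z<N z∈
          (suc zero) false (z<N , z∉) → ≤-trans z<N (m≤n⊔m (bound q) N) ,
            λ z∈ → z∉ (s′ , q , rq , z∈)
          (suc (suc i)) → ↾-⊑)
        sat′))

  Achieved : Three → Code × ℕ → Set
  Achieved t (e , k) = (∃[ z ] k ≤ z × G t z) × (Met t e ⊎ Missed t e)

  achieved : ∀ r → ¬ ¬ (∃[ t ] Achieved t (demand r t , size r))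
  achieved r = reach (suc (code r)) >>= λ (q , p , rp , S , least) →
    case proj₂ (S (valid (code r) rp)) r refl of λ (t , (z , k≤z , z∈) , h) →
    let rq = p , rp , S , least in
    return (t , (z , k≤z , suc (code r) , q , rq , z∈) , handled t (demand r t) rq h)

  -- This is why requirements come in triples: if each kind failed at some demand, the triple of
  -- these demands, with the largest size, would still be achieved at one of the kinds.
  some-set : ¬ ¬ (∃[ t ] ∀ ek → ¬ ¬ Achieved t ek)
  some-set none =
    none (≺ , λ (e₀ , k₀) fail₀ →
    none (∥ , λ (e₁ , k₁) fail₁ →
    none (≻ , λ (e₂ , k₂) fail₂ →
    achieved (e₀ , e₁ , e₂ , k₀ ⊔ (k₁ ⊔ k₂)) λ where
      (≺ , (z , k≤z , z∈) , h) → fail₀ ((z , ≤-trans (m≤m⊔n k₀ _) k≤z , z∈) , h)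
      (∥ , (z , k≤z , z∈) , h) →
        fail₁ ((z , ≤-trans (≤-trans (m≤m⊔n k₁ k₂) (m≤n⊔m k₀ _)) k≤z , z∈) , h)
      (≻ , (z , k≤z , z∈) , h) →
        fail₂ ((z , ≤-trans (≤-trans (m≤n⊔m k₁ k₂) (m≤n⊔m k₀ _)) k≤z , z∈) , h))))

◂-totals : ∀ {O : PSet} {G : ℕ → Set} {X} →
           (O ◂ total G ◂ totals X ⊑* O ◂ totals (G ◂ X)) ×
           (O ◂ totals (G ◂ X) ⊑* O ◂ total G ◂ totals X)
◂-totals = (λ { zero _ → id ; (suc zero) _ → id ; (suc (suc _)) _ → id }) ,
           (λ { zero _ → id ; (suc zero) _ → id ; (suc (suc _)) _ → id })

InfiniteSet : (ℕ → Set) → Set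
InfiniteSet G = ∀ k → ¬ ¬ (∃[ z ] k ≤ z × G z)

homogeneous-set : ∀ {c X} → Generic c X → ∀ p⁺ p⁻ →
  let P = ⟪ (λ z → Sat p⁺ (totals X) (const z)) , (λ z → Sat p⁻ (totals X) (const z)) ⟫ in
  IsOrder P →
  ¬ ¬ (∃[ t ] ∃[ G ] InfiniteSet G × Generic c (G ◂ X) ×
       (∀ x y → G x → G y → x < y → Col P t x y))
homogeneous-set generic p⁺ p⁻ order =
  some-set >>= λ (t , all) → return (t , G t ,
    -- A trivial code leaves only the demand for an element from `k` on.
    (λ k → all (equal 𝟎 𝟎 , k) >>= λ (el , _) → return el) ,
    (λ e → all (e , 0) >>= λ where
      (_ , inj₁ met) → return (inj₁ (sat-cont e _ .mono (proj₁ ◂-totals) met))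
      (_ , inj₂ (n , none)) → return (inj₂ (n , λ B m →
        none B m ∘ sat-cont e _ .mono (proj₂ ◂-totals)))) ,
    λ x y → G-hom)
  where open HomogeneousSet generic p⁺ p⁻ order

-- The generic tournament

comprehension : (S : ℕ → Set) → ∀ n →
  ¬ ¬ (∃[ L ] (∀ z → z < n → (S z → z ∈ L) × (z ∈ L → S z)))
comprehension S n = go n >>= λ (L , f , g) → return (L , λ z z<n → f z z<n , g z)
  where
  go : ∀ n → ¬ ¬ (∃[ L ] (∀ z → z < n → S z → z ∈ L) × (∀ z → z ∈ L → S z))
  go zero    = return ([] , (λ _ ()) , λ _ ())
  go (suc n) = go n >>= λ (L , f , g) → lem (S n) >>= λ where
    (inj₁ y) → return (n ∷ L , (λ z z< s → case m≤n⇒m<n∨m≡n z< of λ where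
        (inj₁ (s≤s z<n)) → there (f z z<n s)
        (inj₂ refl) → here refl) ,
      λ { z (here refl) → y ; z (there z∈) → g z z∈ })
    (inj₂ ¬y) → return (L , (λ z z< s → case m≤n⇒m<n∨m≡n z< of λ where
        (inj₁ (s≤s z<n)) → f z z<n s
        (inj₂ refl) → contradiction s ¬y) , g)

-- A vertex x below the height is promised ⌜ x , y ⌝ ∈ edges, for all pairs coded
-- from the height on, iff x ∈ hues.
record Piece : Set where
  constructor piece
  field
    edges  : List ℕ
    hues   : List ℕ
    height : ℕ
open Piece

instance
  Piece-countable : Countable Piece
  Piece-countable .toTree (piece u v ℓ) = toTree (u , v , ℓ)
  Piece-countable .fromTree t = case fromTree t of λ (u , v , ℓ) → piece u v ℓ
  Piece-countable .retract (piece u v ℓ) =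
    cong (λ (u , v , ℓ) → piece u v ℓ) (retract (u , v , ℓ))

∅ : ℕ → ℕ → Set
∅ _ _ = ⊥

module GenericColouring where

  record Ext (p q : Piece) : Set where
    field
      height≤ : height p ≤ height q
      edges⊆  : ∀ z → z < height p → z ∈ edges p → z ∈ edges q
      edges⊇  : ∀ z → z < height p → z ∈ edges q → z ∈ edges p
      hues⊆   : ∀ x → x < height p → x ∈ hues p → x ∈ hues q
      hues⊇   : ∀ x → x < height p → x ∈ hues q → x ∈ hues p
      limit⁺  : ∀ x y → x < height p → height p ≤ ⌜ x , y ⌝ → ⌜ x , y ⌝ < height q →
                x ∈ hues p → ⌜ x , y ⌝ ∈ edges q
      limit⁻  : ∀ x y → x < height p → height p ≤ ⌜ x , y ⌝ → ⌜ x , y ⌝ < height q →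
                ⌜ x , y ⌝ ∈ edges q → x ∈ hues p
  open Ext

  ext-refl : ∀ {p} → Ext p p
  ext-refl = record
    { height≤ = ≤-refl
    ; edges⊆ = λ _ _ → id ; edges⊇ = λ _ _ → id
    ; hues⊆ = λ _ _ → id ; hues⊇ = λ _ _ → id
    ; limit⁺ = λ _ _ _ ≤z z< → contradiction ≤z (<⇒≱ z<)
    ; limit⁻ = λ _ _ _ ≤z z< → contradiction ≤z (<⇒≱ z<)
    }

  ext-trans : ∀ {p q r} → Ext p q → Ext q r → Ext p r
  ext-trans {p} {q} {r} e f = record
    { height≤ = ≤-trans (height≤ e) (height≤ f)
    ; edges⊆ = λ z z< → edges⊆ f z (q< z<) ∘ edges⊆ e z z<
    ; edges⊇ = λ z z< → edges⊇ e z z< ∘ edges⊇ f z (q< z<)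
    ; hues⊆ = λ z z< → hues⊆ f z (q< z<) ∘ hues⊆ e z z<
    ; hues⊇ = λ z z< → hues⊇ e z z< ∘ hues⊇ f z (q< z<)
    ; limit⁺ = λ x y x< ≤z z< x∈ → case ⌜ x , y ⌝ <? height q of λ where
        (yes z<q) → edges⊆ f _ z<q (limit⁺ e x y x< ≤z z<q x∈)
        (no z≮q) → limit⁺ f x y (q< x<) (≮⇒≥ z≮q) z< (hues⊆ e x x< x∈)
    ; limit⁻ = λ x y x< ≤z z< z∈ → case ⌜ x , y ⌝ <? height q of λ where
        (yes z<q) → limit⁻ e x y x< ≤z z<q (edges⊇ f _ z<q z∈)
        (no z≮q) → hues⊇ e x x< (limit⁻ f x y (q< x<) (≮⇒≥ z≮q) z< z∈)
    }
    where
    q< : ∀ {z} → z < height p → z < height q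
    q< z< = ≤-trans z< (height≤ e)

  edge-info hue-info : Piece → PSet
  edge-info p = total (_∈ edges p) ↾ height p
  hue-info p = total (_∈ hues p) ↾ height p

  -- The relation of r may be kept while the limits beyond p are changed at will.
  recolour : ∀ {p r} → Ext p r → ∀ B k → ¬ ¬ (∃[ q ] Ext p q × k ≤ height q ×
    (edge-info r ⊑ edge-info q) × (window B (height p) k ⊑ hue-info q))
  recolour {p} {r} e B k =
    comprehension U L >>= λ (u , u-ok) →
    comprehension V L >>= λ (v , v-ok) →
    let
      <L : ∀ {z} → z < height r → z < L
      <L = λ z< → ≤-trans z< (m≤m⊔n (height r) k)
      p<L : ∀ {z} → z < height p → z < L
      p<L = λ z< → <L (≤-trans z< (height≤ e))
    in return (piece u v L , record
      { height≤ = ≤-trans (height≤ e) (m≤m⊔n (height r) k)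
      ; edges⊆ = λ z z< z∈ → proj₁ (u-ok z (p<L z<))
          (inj₁ (≤-trans z< (height≤ e) , edges⊆ e z z< z∈))
      ; edges⊇ = λ z z< z∈ → case proj₂ (u-ok z (p<L z<)) z∈ of λ where
          (inj₁ (_ , z∈r)) → edges⊇ e z z< z∈r
          (inj₂ (r≤z , _)) → contradiction r≤z (<⇒≱ (≤-trans z< (height≤ e)))
      ; hues⊆ = λ x x< x∈ → proj₁ (v-ok x (p<L x<)) (inj₁ (x< , x∈))
      ; hues⊇ = λ x x< x∈ → case proj₂ (v-ok x (p<L x<)) x∈ of λ where
          (inj₁ (_ , x∈p)) → x∈p
          (inj₂ (p≤x , _)) → contradiction p≤x (<⇒≱ x<)
      ; limit⁺ = λ x y x< ≤z z< x∈ → proj₁ (u-ok _ z<) (case ⌜ x , y ⌝ <? height r of λ where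
          (yes z<r) → inj₁ (z<r , limit⁺ e x y x< ≤z z<r x∈)
          (no z≮r) → inj₂ (≮⇒≥ z≮r , x , y , refl , x< , x∈))
      ; limit⁻ = λ x y x< ≤z z< z∈ → case proj₂ (u-ok _ z<) z∈ of λ where
          (inj₁ (z<r , z∈r)) → limit⁻ e x y x< ≤z z<r z∈r
          (inj₂ (_ , x′ , y′ , z≡ , _ , x′∈)) →
            subst (_∈ hues p) (sym (proj₁ (pair-injective {x} {y} {x′} {y′} z≡))) x′∈
      } , m≤n⊔m (height r) k ,
      (λ where
        true (z< , z∈) → <L z< , proj₁ (u-ok _ (<L z<)) (inj₁ (z< , z∈))
        false (z< , z∉) → <L z< , λ z∈ → case proj₂ (u-ok _ (<L z<)) z∈ of λ where
          (inj₁ (_ , z∈r)) → z∉ z∈r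
          (inj₂ (r≤z , _)) → <⇒≱ z< r≤z) ,
      (λ where
        true (p≤z , z< , Bz) → let z<L = ≤-trans z< (m≤n⊔m (height r) k) in
          z<L , proj₁ (v-ok _ z<L) (inj₂ (p≤z , Bz))
        false (p≤z , z< , Bz) → let z<L = ≤-trans z< (m≤n⊔m (height r) k) in
          z<L , λ z∈ → case proj₂ (v-ok _ z<L) z∈ of λ where
            (inj₁ (z<p , _)) → <⇒≱ z<p p≤z
            (inj₂ (_ , Bz′)) → case trans (sym Bz) Bz′ of λ ()))
    where
    L : ℕ
    L = height r ⊔ k
    -- Edges follow `r` as far as it goes and then the limits promised by `p`. Hues follow `p` below
    -- its height; from there on `p` promises nothing, so those of `r` may be replaced by `B`.
    U V : ℕ → Set
    U z = (z < height r × z ∈ edges r) ⊎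
          (height r ≤ z × (∃[ x ] ∃[ y ] z ≡ ⌜ x , y ⌝ × x < height p × x ∈ hues p))
    V x = (x < height p × x ∈ hues p) ⊎ (height p ≤ x × B x ≡ true)

  Handled : Code → Piece → Set
  Handled e p = Sat e (hue-info p ◂ edge-info p ◂ totals ∅) (const 0) ⊎
    (∃[ n ] ∀ r → Ext p r → ∀ B m →
      ¬ Sat e (window B n m ◂ edge-info r ◂ totals ∅) (const 0))

  Step : ℕ → Piece → Piece → Set
  Step s p q = Ext p q × s ≤ height q × (∀ e → code e ≡ s → Handled e q)

  -- If some extension satisfies `e` with some colours from `height p` on, `recolour` makes these
  -- its hues and keeps its edges. Otherwise `height p` is the bound beyond which `e` fails.
  handle : ∀ e s p → ¬ ¬ (∃[ q ] Ext p q × s ≤ height q × Handled e q)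
  handle e s p =
    lem (∃[ r ] ∃[ B ] ∃[ m ] Ext p r ×
         Sat e (window B (height p) m ◂ edge-info r ◂ totals ∅) (const 0)) >>= λ where
      (inj₁ (r , B , m , er , sat)) →
        recolour er B (m ⊔ s) >>= λ (q , eq , k≤ , edge⊑ , hue⊑) →
        return (q , eq , ≤-trans (m≤n⊔m m s) k≤ , inj₁ (sat-mono₂ e
          (λ b (≤z , z< , Bz) → hue⊑ b (≤z , ≤-trans z< (m≤m⊔n m s) , Bz)) edge⊑ sat))
      (inj₂ none) →
        recolour ext-refl (const true) s >>= λ (q , eq , s≤ , _) →
        return (q , eq , s≤ , inj₂ (height p , λ r er B m sat →
          none (r , B , m , ext-trans eq er , sat)))

  step : ∀ s p → ¬ ¬ (∃ (Step s p))
  step s p = lem (∃[ e ] code e ≡ s) >>= λ where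
    (inj₁ (e , e≡s)) → handle e s p >>= λ (q , eq , s≤ , h) →
      return (q , eq , s≤ , λ e′ e′≡s →
        subst (λ e → Handled e q) (code-injective (trans e≡s (sym e′≡s))) h)
    (inj₂ none) → recolour ext-refl (const true) s >>= λ (q , eq , s≤ , _) →
      return (q , eq , s≤ , λ e e≡s → contradiction (e , e≡s) none)

  open Choice Step step (piece [] [] 0)

  extends : ∀ {s t p q} → s ≤ t → Reach s p → Reach t q → Ext p q
  extends = reach-≤ (const ⊤) Ext ext-refl ext-trans tt λ s _ S → tt , proj₁ S

  reach-high : ∀ s k → ¬ ¬ (∃[ s′ ] ∃[ p ] s ≤ s′ × Reach s′ p × k ≤ height p)
  reach-high s k = reach (suc (s ⊔ k)) >>= λ (q , p , rp , S , l) →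
    return (suc (s ⊔ k) , q , m≤n⇒m≤1+n (m≤m⊔n s k) , (p , rp , S , l) ,
            ≤-trans (m≤n⊔m s k) (proj₁ (proj₂ S)))

  U c : ℕ → Set
  U z = ∃[ s ] ∃[ p ] Reach s p × z < height p × z ∈ edges p
  c x = ∃[ s ] ∃[ p ] Reach s p × x < height p × x ∈ hues p

  U-at : ∀ {s p z} → Reach s p → z < height p → U z → z ∈ edges p
  U-at {s} rp z<p (s′ , q , rq , z<q , z∈) = case ≤-total s s′ of λ where
    (inj₁ s≤s′) → edges⊇ (extends s≤s′ rp rq) _ z<p z∈
    (inj₂ s′≤s) → edges⊆ (extends s′≤s rq rp) _ z<q z∈

  c-at : ∀ {s p z} → Reach s p → z < height p → c z → z ∈ hues p
  c-at {s} rp z<p (s′ , q , rq , z<q , z∈) = case ≤-total s s′ of λ where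
    (inj₁ s≤s′) → hues⊇ (extends s≤s′ rp rq) _ z<p z∈
    (inj₂ s′≤s) → hues⊆ (extends s′≤s rq rp) _ z<q z∈

  edge-info⊑ : ∀ {s p} → Reach s p → edge-info p ⊑ total U
  edge-info⊑ {s} {p} rp true  (z< , z∈) = s , p , rp , z< , z∈
  edge-info⊑ rp false (z< , z∉) = z∉ ∘ U-at rp z<

  hue-info⊑ : ∀ {s p} → Reach s p → hue-info p ⊑ total c
  hue-info⊑ {s} {p} rp true  (z< , z∈) = s , p , rp , z< , z∈
  hue-info⊑ rp false (z< , z∉) = z∉ ∘ c-at rp z<

  U-generic : Generic c (U ◂ ∅)
  U-generic e = reach (suc (code e)) >>= λ (q , p , rp , S , l) →
    let rq = p , rp , S , l in
    case proj₂ (proj₂ S) e refl of λ where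
      (inj₁ sat) → return (inj₁ (sat-cont e _ .mono (proj₁ ◂-totals)
        (sat-mono₂ e (hue-info⊑ rq) (edge-info⊑ rq) sat)))
      (inj₂ (n , none)) → return (inj₂ (n , λ B m sat →
        case sat-cont e _ .compact
               (sat-cont e _ .mono (proj₂ ◂-totals) sat) of λ (N , sat′) →
        reach-high (suc (code e)) N λ (s′ , r , s≤s′ , rr , N≤) →
        none r (extends s≤s′ rq rr) B m (sat-cont e _ .mono
          (λ where
            zero → ↾-⊑
            (suc zero) true (z<N , z∈) → ≤-trans z<N N≤ , U-at rr (≤-trans z<N N≤) z∈
            (suc zero) false (z<N , z∉) → ≤-trans z<N N≤ , λ z∈ →
              z∉ (s′ , r , rr , ≤-trans z<N N≤ , z∈)
            (suc (suc i)) → ↾-⊑)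
          sat′)))

  -- The bound `k` is the height of a reached piece whose height exceeds `x`; all later pieces keep
  -- its promise for `x`.
  U-limit : ∀ x → ¬ ¬ (∃[ k ] ∀ y → k ≤ y →
            (c x → ¬ ¬ U ⌜ x , y ⌝) × (U ⌜ x , y ⌝ → c x))
  U-limit x = reach-high 0 (suc x) >>= λ (s , p , _ , rp , x<p) →
    return (height p , λ y p≤y →
      let p≤z = ≤-trans p≤y (pair-≥ʳ x y) in
      (λ cx → reach-high s (suc ⌜ x , y ⌝) >>= λ (s′ , q , s≤s′ , rq , z<q) →
        return (s′ , q , rq , z<q , limit⁺ (extends s≤s′ rp rq) x y x<p p≤z z<q (c-at rp x<p cx))) ,
      λ (s′ , q , rq , z<q , z∈) → case ≤-total s s′ of λ where
        (inj₁ s≤s′) → s , p , rp , x<p , limit⁻ (extends s≤s′ rp rq) x y x<p p≤z z<q z∈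
        (inj₂ s′≤s) → contradiction (≤-trans (height≤ (extends s′≤s rq rp)) p≤z) (<⇒≱ z<q))

-- Forcing semantics

record World (c : ℕ → Set) : Set₁ where
  field
    sets    : ℕ → ℕ → Set
    generic : Generic c sets
open World

NumEnv : ℕ → Set
NumEnv n = Fin n → ℕ

SetEnv : ℕ → Set₁
SetEnv k = Fin k → ℕ → Set

⟦_⟧ᵗ : ∀ {n} → Term n → NumEnv n → ℕ
⟦ var i ⟧ᵗ ρ = ρ i
⟦ 𝟎 ⟧ᵗ     ρ = 0
⟦ 𝟏 ⟧ᵗ     ρ = 1
⟦ s + t ⟧ᵗ ρ = ⟦ s ⟧ᵗ ρ +ℕ ⟦ t ⟧ᵗ ρ
⟦ s · t ⟧ᵗ ρ = ⟦ s ⟧ᵗ ρ *ℕ ⟦ t ⟧ᵗ ρ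

-- Forcing over the worlds, in the classical (weak) sense: a world forces a
-- disjunction or an existential statement if no extension refutes all cases.
module Forcing (c : ℕ → Set) where

  infix 4 _⊆_
  -- The second order part of a world consists of the sets computable in it, and worlds are compared
  -- by these parts and not by their sequences of oracles.
  record _⊆_ (w v : World c) : Set₁ where
    constructor mk⊆
    field carry : ∀ {Y} → Y ≼ sets w → Y ≼ sets v
  open _⊆_

  ⊆-refl : ∀ {w} → w ⊆ w
  ⊆-refl = mk⊆ id

  ⊆-trans : ∀ {w v u} → w ⊆ v → v ⊆ u → w ⊆ u
  ⊆-trans w⊆v v⊆u = mk⊆ (carry v⊆u ∘ carry w⊆v)

  Never : (World c → Set₁) → World c → Set₁
  Never Φ w = ∀ {v} → w ⊆ v → ¬ Φ v

  -- The numbers are the same in all worlds while the sets grow, hence the difference between `∀₁`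
  -- and `∀₂`.
  Force : ∀ {n k} → NumEnv n → SetEnv k → Formula n k → World c → Set₁
  Force ρ η (s ≐ t) w = Lift _ (⟦ s ⟧ᵗ ρ ≡ ⟦ t ⟧ᵗ ρ)
  Force ρ η (s ⋖ t) w = Lift _ (⟦ s ⟧ᵗ ρ < ⟦ t ⟧ᵗ ρ)
  Force ρ η (t ϵ j) w = Lift _ (¬ ¬ η j (⟦ t ⟧ᵗ ρ))
  Force ρ η ⊥̇       w = Lift _ ⊥
  Force ρ η (φ ⇒ ψ) w = ∀ {v} → w ⊆ v → Force ρ η φ v → Force ρ η ψ v
  Force ρ η (φ ∧ ψ) w = Force ρ η φ w × Force ρ η ψ w
  Force ρ η (φ ∨ ψ) w = ∀ {v} → w ⊆ v → Never (Force ρ η φ) v → ¬ Never (Force ρ η ψ) v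
  Force ρ η (∀₁ φ)  w = ∀ a → Force (a Vector.∷ ρ) η φ w
  Force ρ η (∃₁ φ)  w = ∀ {v} → w ⊆ v → ¬ (∀ a → Never (Force (a Vector.∷ ρ) η φ) v)
  Force ρ η (∀₂ φ)  w = ∀ {v} → w ⊆ v → ∀ Y → Y ≼ sets v → Force ρ (Y Vector.∷ η) φ v
  Force ρ η (∃₂ φ)  w = ∀ {v} → w ⊆ v →
    ¬ (∀ {u} → v ⊆ u → ∀ Y → Y ≼ sets u → ¬ Force ρ (Y Vector.∷ η) φ u)

  persist : ∀ {n k} (φ : Formula n k) {ρ η w v} → w ⊆ v → Force ρ η φ w → Force ρ η φ v
  persist (s ≐ t) w⊆v f = f
  persist (s ⋖ t) w⊆v f = f
  persist (t ϵ j) w⊆v f = f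
  persist ⊥̇       w⊆v f = f
  persist (φ ⇒ ψ) w⊆v f v⊆u = f (⊆-trans w⊆v v⊆u)
  persist (φ ∧ ψ) w⊆v (f , g) = persist φ w⊆v f , persist ψ w⊆v g
  persist (φ ∨ ψ) w⊆v f v⊆u = f (⊆-trans w⊆v v⊆u)
  persist (∀₁ φ)  w⊆v f a = persist φ w⊆v (f a)
  persist (∃₁ φ)  w⊆v f v⊆u = f (⊆-trans w⊆v v⊆u)
  persist (∀₂ φ)  w⊆v f v⊆u = f (⊆-trans w⊆v v⊆u)
  persist (∃₂ φ)  w⊆v f v⊆u = f (⊆-trans w⊆v v⊆u)

  Densely : (World c → Set₁) → World c → Set₁
  Densely Φ w = ∀ {v} → w ⊆ v → ¬ Never Φ v

  densely-map : ∀ {Φ Ψ w} → (∀ {v} → w ⊆ v → Φ v → Ψ v) → Densely Φ w → Densely Ψ w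
  densely-map f d w⊆v never = d w⊆v λ v⊆u → never v⊆u ∘ f (⊆-trans w⊆v v⊆u)

  -- Validates `raa`. Atomic formulas are decidable or negated, disjunction and existence are read
  -- negatively, and the other connectives inherit stability.
  stable : ∀ {n k} (φ : Formula n k) {ρ η w} → Densely (Force ρ η φ) w → Force ρ η φ w
  stable (s ≐ t) d = lift (decidable-stable (_ ≟ _) λ n → d ⊆-refl λ _ f → n (lower f))
  stable (s ⋖ t) d = lift (decidable-stable (_ <? _) λ n → d ⊆-refl λ _ f → n (lower f))
  stable (t ϵ j) d = lift λ n → d ⊆-refl λ _ f → lower f n
  stable ⊥̇       d = lift (d ⊆-refl λ _ → lower)
  stable (φ ⇒ ψ) d w⊆v f = stable ψ λ v⊆u →
    densely-map (λ v⊆u g → g ⊆-refl (persist φ v⊆u f)) (λ v⊆u → d (⊆-trans w⊆v v⊆u)) v⊆u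
  stable (φ ∧ ψ) d = stable φ (densely-map (λ _ → proj₁) d) , stable ψ (densely-map (λ _ → proj₂) d)
  stable (φ ∨ ψ) d w⊆v nφ nψ = d w⊆v λ v⊆u f →
    f ⊆-refl (λ u⊆t → nφ (⊆-trans v⊆u u⊆t)) (λ u⊆t → nψ (⊆-trans v⊆u u⊆t))
  stable (∀₁ φ)  d a = stable φ (densely-map (λ _ f → f a) d)
  stable (∃₁ φ)  d w⊆v n = d w⊆v λ v⊆u f → f ⊆-refl λ a u⊆t → n a (⊆-trans v⊆u u⊆t)
  stable (∀₂ φ)  d w⊆v Y Y≼ = stable φ λ v⊆u →
    densely-map (λ v⊆u f → f ⊆-refl Y (carry v⊆u Y≼)) (λ v⊆u → d (⊆-trans w⊆v v⊆u)) v⊆u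
  stable (∃₂ φ)  d w⊆v n = d w⊆v λ v⊆u f → f ⊆-refl λ u⊆t → n (⊆-trans v⊆u u⊆t)

  ⟦sub⟧ : ∀ {n m} (t : Term n) {σ : Fin n → Term m} {ρ ρ′} →
          (∀ i → ⟦ σ i ⟧ᵗ ρ ≡ ρ′ i) → ⟦ t [ σ ]ᵗ ⟧ᵗ ρ ≡ ⟦ t ⟧ᵗ ρ′
  ⟦sub⟧ (var i) h = h i
  ⟦sub⟧ 𝟎       h = refl
  ⟦sub⟧ 𝟏       h = refl
  ⟦sub⟧ (s + t) h = cong₂ _+ℕ_ (⟦sub⟧ s h) (⟦sub⟧ t h)
  ⟦sub⟧ (s · t) h = cong₂ _*ℕ_ (⟦sub⟧ s h) (⟦sub⟧ t h)

  ⟦wk⟧ : ∀ {n} (t : Term n) {a ρ} → ⟦ wkᵗ t ⟧ᵗ (a Vector.∷ ρ) ≡ ⟦ t ⟧ᵗ ρ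
  ⟦wk⟧ t = ⟦sub⟧ t λ _ → refl

  lift₁-env : ∀ {n m} (σ : Fin n → Term m) {ρ ρ′ a} → (∀ i → ⟦ σ i ⟧ᵗ ρ ≡ ρ′ i) →
              ∀ i → ⟦ lift₁ σ i ⟧ᵗ (a Vector.∷ ρ) ≡ (a Vector.∷ ρ′) i
  lift₁-env σ h zero = refl
  lift₁-env σ h (suc i) = trans (⟦wk⟧ (σ i)) (h i)

  lift₂-env : ∀ {k l} {τ : Fin k → Fin l} {η : SetEnv l} {η′ Y} → (∀ j → η (τ j) ≡ η′ j) →
              ∀ j → (Y Vector.∷ η) (Fin.lift 1 τ j) ≡ (Y Vector.∷ η′) j
  lift₂-env h zero    = refl
  lift₂-env h (suc j) = h j

  mutual
    -- Proved together with `sub⁺`, as the premise of an implication swaps the direction.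
    -- Environments are compared pointwise, for want of function extensionality.
    sub⁻ : ∀ {n m k l} (φ : Formula n k) {σ : Fin n → Term m} {τ : Fin k → Fin l} {ρ ρ′ η η′} →
      (∀ i → ⟦ σ i ⟧ᵗ ρ ≡ ρ′ i) → (∀ j → η (τ j) ≡ η′ j) →
      ∀ {w} → Force ρ η (sub σ τ φ) w → Force ρ′ η′ φ w
    sub⁻ (s ≐ t) h g (lift f) = lift (trans (sym (⟦sub⟧ s h)) (trans f (⟦sub⟧ t h)))
    sub⁻ (s ⋖ t) h g (lift f) = lift (subst₂ _<_ (⟦sub⟧ s h) (⟦sub⟧ t h) f)
    sub⁻ (t ϵ j) h g (lift f) = lift (subst₂ (λ Y z → ¬ ¬ Y z) (g j) (⟦sub⟧ t h) f)
    sub⁻ ⊥̇       h g f = f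
    sub⁻ (φ ⇒ ψ) h g f w⊆v = sub⁻ ψ h g ∘ f w⊆v ∘ sub⁺ φ h g
    sub⁻ (φ ∧ ψ) h g (f₁ , f₂) = sub⁻ φ h g f₁ , sub⁻ ψ h g f₂
    sub⁻ (φ ∨ ψ) h g f w⊆v nφ nψ =
      f w⊆v (λ v⊆u → nφ v⊆u ∘ sub⁻ φ h g) (λ v⊆u → nψ v⊆u ∘ sub⁻ ψ h g)
    sub⁻ (∀₁ φ)  {σ} h g f a = sub⁻ φ (lift₁-env σ h) g (f a)
    sub⁻ (∃₁ φ)  {σ} h g f w⊆v n = f w⊆v λ a v⊆u → n a v⊆u ∘ sub⁻ φ (lift₁-env σ h) g
    sub⁻ (∀₂ φ)  h g f w⊆v Y Y≼ = sub⁻ φ h (lift₂-env g) (f w⊆v Y Y≼)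
    sub⁻ (∃₂ φ)  h g f w⊆v n = f w⊆v λ v⊆u Y Y≼ → n v⊆u Y Y≼ ∘ sub⁻ φ h (lift₂-env g)

    sub⁺ : ∀ {n m k l} (φ : Formula n k) {σ : Fin n → Term m} {τ : Fin k → Fin l} {ρ ρ′ η η′} →
      (∀ i → ⟦ σ i ⟧ᵗ ρ ≡ ρ′ i) → (∀ j → η (τ j) ≡ η′ j) →
      ∀ {w} → Force ρ′ η′ φ w → Force ρ η (sub σ τ φ) w
    sub⁺ (s ≐ t) h g (lift f) = lift (trans (⟦sub⟧ s h) (trans f (sym (⟦sub⟧ t h))))
    sub⁺ (s ⋖ t) h g (lift f) = lift (subst₂ _<_ (sym (⟦sub⟧ s h)) (sym (⟦sub⟧ t h)) f)
    sub⁺ (t ϵ j) h g (lift f) = lift (subst₂ (λ Y z → ¬ ¬ Y z) (sym (g j)) (sym (⟦sub⟧ t h)) f)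
    sub⁺ ⊥̇       h g f = f
    sub⁺ (φ ⇒ ψ) h g f w⊆v = sub⁺ ψ h g ∘ f w⊆v ∘ sub⁻ φ h g
    sub⁺ (φ ∧ ψ) h g (f₁ , f₂) = sub⁺ φ h g f₁ , sub⁺ ψ h g f₂
    sub⁺ (φ ∨ ψ) h g f w⊆v nφ nψ =
      f w⊆v (λ v⊆u → nφ v⊆u ∘ sub⁺ φ h g) (λ v⊆u → nψ v⊆u ∘ sub⁺ ψ h g)
    sub⁺ (∀₁ φ)  {σ} h g f a = sub⁺ φ (lift₁-env σ h) g (f a)
    sub⁺ (∃₁ φ)  {σ} h g f w⊆v n = f w⊆v λ a v⊆u → n a v⊆u ∘ sub⁺ φ (lift₁-env σ h) g
    sub⁺ (∀₂ φ)  h g f w⊆v Y Y≼ = sub⁺ φ h (lift₂-env g) (f w⊆v Y Y≼)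
    sub⁺ (∃₂ φ)  h g f w⊆v n = f w⊆v λ v⊆u Y Y≼ → n v⊆u Y Y≼ ∘ sub⁺ φ h (lift₂-env g)

  inst-env : ∀ {n} (t : Term n) {ρ} i → ⟦ (t Vector.∷ var) i ⟧ᵗ ρ ≡ (⟦ t ⟧ᵗ ρ Vector.∷ ρ) i
  inst-env t zero    = refl
  inst-env t (suc i) = refl

  inst-setenv : ∀ {k} (X : Fin k) {η : SetEnv k} j → η ((X Vector.∷ id) j) ≡ (η X Vector.∷ η) j
  inst-setenv X zero    = refl
  inst-setenv X (suc j) = refl

  Computable : ∀ {k} → SetEnv k → (ℕ → ℕ → Set) → Set
  Computable η X = ∀ j → η j ≼ X

  computable-∷ : ∀ {k Y} {η : SetEnv k} {X} → Y ≼ X → Computable η X →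
                 Computable (Y Vector.∷ η) X
  computable-∷ y h zero    = y
  computable-∷ y h (suc j) = h j

  Models : Theory → Set₁
  Models T = ∀ φ → T φ → ∀ w → Force (λ ()) (λ ()) φ w

  module _ {T : Theory} (model : Models T) where

    -- Free set variables denote sets of the world, so that `∀₂E` and `∃₂I` may instantiate set
    -- quantifiers by them.
    sound : ∀ {n k} {Γ : List (Formula n k)} {φ} → T ∣ Γ ⊢ φ →
      ∀ {ρ η w} → Computable η (sets w) → (∀ {ψ} → ψ ∈ Γ → Force ρ η ψ w) → Force ρ η φ w

    private
      sound-∷ : ∀ {n k} {Γ : List (Formula n k)} {φ ψ} → T ∣ ψ ∷ Γ ⊢ φ →
        ∀ {ρ η w v} → Computable η (sets w) → (∀ {ψ} → ψ ∈ Γ → Force ρ η ψ w) →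
        w ⊆ v → Force ρ η ψ v → Force ρ η φ v
      sound-∷ d comp γ w⊆v f = sound d (λ j → carry w⊆v (comp j)) λ where
        (here refl) → f
        {ψ} (there ψ∈) → persist ψ w⊆v (γ ψ∈)

      wk₁-Γ : ∀ {n k} {Γ : List (Formula n k)} {ρ η w} a →
        (∀ {ψ} → ψ ∈ Γ → Force ρ η ψ w) → ∀ {ψ} → ψ ∈ map wk₁ Γ → Force (a Vector.∷ ρ) η ψ w
      wk₁-Γ a γ ψ∈ = case ∈-map⁻ wk₁ ψ∈ of λ where
        (ψ , ψ∈Γ , refl) → sub⁺ ψ (λ _ → refl) (λ _ → refl) (γ ψ∈Γ)

      wk₂-Γ : ∀ {n k} {Γ : List (Formula n k)} {ρ η w} Y →
        (∀ {ψ} → ψ ∈ Γ → Force ρ η ψ w) → ∀ {ψ} → ψ ∈ map wk₂ Γ → Force ρ (Y Vector.∷ η) ψ w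
      wk₂-Γ Y γ ψ∈ = case ∈-map⁻ wk₂ ψ∈ of λ where
        (ψ , ψ∈Γ , refl) → sub⁺ ψ (λ _ → refl) (λ _ → refl) (γ ψ∈Γ)

    sound (axiom {φ = φ} Tφ) {w = w} comp γ = sub⁺ φ (λ ()) (λ ()) (model φ Tφ w)
    sound (hyp φ∈) comp γ = γ φ∈
    sound (raa {φ = φ} d) comp γ = stable φ λ w⊆v never →
      lower (sound-∷ d comp γ w⊆v λ v⊆u f → lift (never v⊆u f))
    sound (⇒I d) comp γ w⊆v f = sound-∷ d comp γ w⊆v f
    sound (⇒E d e) comp γ = sound d comp γ ⊆-refl (sound e comp γ)
    sound (∧I d e) comp γ = sound d comp γ , sound e comp γ
    sound (∧E₁ d) comp γ = proj₁ (sound d comp γ)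
    sound (∧E₂ d) comp γ = proj₂ (sound d comp γ)
    sound (∨I₁ {φ = φ} d) comp γ w⊆v nφ nψ = nφ ⊆-refl (persist φ w⊆v (sound d comp γ))
    sound (∨I₂ {ψ = ψ} d) comp γ w⊆v nφ nψ = nψ ⊆-refl (persist ψ w⊆v (sound d comp γ))
    sound (∨E {χ = χ} d e₁ e₂) comp γ = stable χ λ w⊆v never →
      sound d comp γ w⊆v
        (λ v⊆u f → never v⊆u (sound-∷ e₁ comp γ (⊆-trans w⊆v v⊆u) f))
        (λ v⊆u f → never v⊆u (sound-∷ e₂ comp γ (⊆-trans w⊆v v⊆u) f))
    sound (∀₁I d) comp γ a = sound d comp (wk₁-Γ a γ)
    sound (∀₁E {φ = φ} d t) {ρ} comp γ =
      sub⁺ φ (inst-env t) (λ _ → refl) (sound d comp γ (⟦ t ⟧ᵗ ρ))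
    sound (∃₁I {φ = φ} t d) {ρ} comp γ w⊆v n =
      n (⟦ t ⟧ᵗ ρ) ⊆-refl (persist φ w⊆v (sub⁻ φ (inst-env t) (λ _ → refl) (sound d comp γ)))
    sound (∃₁E {χ = χ} d e) comp γ = stable χ λ w⊆v never →
      sound d comp γ w⊆v λ a v⊆u f → never v⊆u
        (sub⁻ χ (λ _ → refl) (λ _ → refl) (sound-∷ e comp (wk₁-Γ a γ) (⊆-trans w⊆v v⊆u) f))
    sound (∀₂I d) comp γ w⊆v Y Y≼ = sound d (computable-∷ Y≼ (λ j → carry w⊆v (comp j)))
      (wk₂-Γ Y λ {ψ} ψ∈ → persist ψ w⊆v (γ ψ∈))
    sound (∀₂E {φ = φ} d X) {η = η} comp γ =
      sub⁺ φ (λ _ → refl) (inst-setenv X) (sound d comp γ ⊆-refl (η X) (comp X))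
    sound (∃₂I {φ = φ} X d) {η = η} comp γ w⊆v n =
      n ⊆-refl (η X) (carry w⊆v (comp X))
        (persist φ w⊆v (sub⁻ φ (λ _ → refl) (inst-setenv X) (sound d comp γ)))
    sound (∃₂E {χ = χ} d e) comp γ = stable χ λ w⊆v never →
      sound d comp γ w⊆v λ v⊆u Y Y≼ f → never v⊆u
        (sub⁻ χ (λ _ → refl) (λ _ → refl)
          (sound e (computable-∷ Y≼ (λ j → carry v⊆u (carry w⊆v (comp j)))) λ where
            (here refl) → f
            {ψ} (there ψ∈) → wk₂-Γ Y (λ {ψ} ψ∈ → persist ψ (⊆-trans w⊆v v⊆u) (γ ψ∈)) ψ∈))
    sound (≐I t) comp γ = lift refl
    sound (≐E {s = s} {t} φ d e) {ρ} {η} {w} comp γ =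
      sub⁺ φ (inst-env t) (λ _ → refl)
        (subst (λ a → Force (a Vector.∷ ρ) η φ w) (lower (sound d comp γ))
          (sub⁻ φ (inst-env s) (λ _ → refl) (sound e comp γ)))

-- Comprehension in the worlds

tm : ∀ {n} → Term n → Tm
tm (var i) = var (toℕ i)
tm 𝟎       = 𝟎
tm 𝟏       = 𝟏
tm (s + t) = tm s + tm t
tm (s · t) = tm s · tm t

Agree : ∀ {n} → NumEnv n → Env → Set
Agree ρ ρ′ = ∀ i → ρ′ (toℕ i) ≡ ρ i

agree-∷ : ∀ {n} {ρ : NumEnv n} {ρ′} a → Agree ρ ρ′ → Agree (a Vector.∷ ρ) (a ◂ ρ′)
agree-∷ a h zero    = refl
agree-∷ a h (suc i) = h i

agree-prefix : ∀ {n} (ρ : NumEnv n) {ρ′} → Agree ρ (prefix (tabulate ρ) ρ′)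
agree-prefix ρ zero    = refl
agree-prefix ρ (suc i) = agree-prefix (ρ ∘ suc) i

⟦tm⟧ : ∀ {n} (t : Term n) {ρ ρ′} → Agree ρ ρ′ → ⟦ tm t ⟧ ρ′ ≡ ⟦ t ⟧ᵗ ρ
⟦tm⟧ (var i) h = h i
⟦tm⟧ 𝟎       h = refl
⟦tm⟧ 𝟏       h = refl
⟦tm⟧ (s + t) h = cong₂ _+ℕ_ (⟦tm⟧ s h) (⟦tm⟧ t h)
⟦tm⟧ (s · t) h = cong₂ _*ℕ_ (⟦tm⟧ s h) (⟦tm⟧ t h)

module Comprehension {c : ℕ → Set} where
  open Forcing c
  open _≼_

  module _ {X k} {η : SetEnv k} (comp : Computable η X) where

    private
      O : Oracles
      O = totals X

    -- Codes are positive, so truth and falsity of a bounded formula are coded separately.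
    yea nay : ∀ {n} {φ : Formula n k} → Σ⁰₀ φ → Code
    yea (s ≐ t)  = equal (tm s) (tm t)
    yea (s ⋖ t)  = less (tm s) (tm t)
    yea (t ϵ j)  = call (pos (comp j)) (tm t)
    yea ⊥̇        = less 𝟎 𝟎
    yea (φ ⇒ ψ)  = or (nay φ) (yea ψ)
    yea (φ ∧ ψ)  = and (yea φ) (yea ψ)
    yea (φ ∨ ψ)  = or (yea φ) (yea ψ)
    yea (∀< t φ) = all< (tm t) (yea φ)
    yea (∃< t φ) = some< (tm t) (yea φ)
    nay (s ≐ t)  = or (less (tm s) (tm t)) (less (tm t) (tm s))
    nay (s ⋖ t)  = less (tm t) (tm s + 𝟏)
    nay (t ϵ j)  = call (neg (comp j)) (tm t)
    nay ⊥̇        = equal 𝟎 𝟎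
    nay (φ ⇒ ψ)  = and (yea φ) (nay ψ)
    nay (φ ∧ ψ)  = or (nay φ) (nay ψ)
    nay (φ ∨ ψ)  = and (nay φ) (nay ψ)
    nay (∀< t φ) = some< (tm t) (nay φ)
    nay (∃< t φ) = all< (tm t) (nay φ)

    mutual
      -- The world is arbitrary: bounded formulas are absolute, as they speak only of numbers and
      -- the fixed sets `η`.
      yea-sound : ∀ {n} {φ : Formula n k} (δ : Σ⁰₀ φ) {ρ ρ′ w} → Agree ρ ρ′ →
                  Sat (yea δ) O ρ′ → Force ρ η φ w
      yea-sound (s ≐ t) h p = lift (trans (sym (⟦tm⟧ s h)) (trans p (⟦tm⟧ t h)))
      yea-sound (s ⋖ t) h p = lift (subst₂ _<_ (⟦tm⟧ s h) (⟦tm⟧ t h) p)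
      yea-sound (t ϵ j) h p = lift (subst (λ z → ¬ ¬ η j z) (⟦tm⟧ t h) (pos-sound (comp j) p))
      yea-sound (φ ⇒ ψ) h (inj₁ p) _ f = ⊥-elim (nay-sound φ h p f)
      yea-sound (φ ⇒ ψ) h (inj₂ q) _ _ = yea-sound ψ h q
      yea-sound (φ ∧ ψ) h (p , q) = yea-sound φ h p , yea-sound ψ h q
      yea-sound (φ ∨ ψ) h (inj₁ p) _ nφ nψ = nφ ⊆-refl (yea-sound φ h p)
      yea-sound (φ ∨ ψ) h (inj₂ q) _ nφ nψ = nψ ⊆-refl (yea-sound ψ h q)
      yea-sound (∀< t φ) h p a _ (lift a<t) = yea-sound φ (agree-∷ a h)
        (p a (subst (a <_) (trans (⟦wk⟧ t) (sym (⟦tm⟧ t h))) a<t))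
      yea-sound (∃< t φ) h (a , a<t , p) _ never = never a ⊆-refl
        (lift (subst (a <_) (trans (⟦tm⟧ t h) (sym (⟦wk⟧ t))) a<t) , yea-sound φ (agree-∷ a h) p)

      nay-sound : ∀ {n} {φ : Formula n k} (δ : Σ⁰₀ φ) {ρ ρ′ w} → Agree ρ ρ′ →
                  Sat (nay δ) O ρ′ → ¬ Force ρ η φ w
      nay-sound (s ≐ t) h p (lift f) =
        case trans (⟦tm⟧ s h) (trans f (sym (⟦tm⟧ t h))) , p of λ where
          (s≡t , inj₁ s<t) → <⇒≢ s<t s≡t
          (s≡t , inj₂ t<s) → >⇒≢ t<s s≡t
      nay-sound (s ⋖ t) {ρ′ = ρ′} h p (lift f) =
        <⇒≱ (subst₂ _<_ (sym (⟦tm⟧ s h)) (sym (⟦tm⟧ t h)) f)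
            (s≤s⁻¹ (subst (⟦ tm t ⟧ ρ′ <_) (+-comm (⟦ tm s ⟧ ρ′) 1) p))
      nay-sound (t ϵ j) h p (lift f) = subst (λ z → ¬ ¬ η j z) (sym (⟦tm⟧ t h)) f (neg-sound (comp j) p)
      nay-sound ⊥̇       h p (lift ())
      nay-sound (φ ⇒ ψ) h (p , q) f = nay-sound ψ h q (f ⊆-refl (yea-sound φ h p))
      nay-sound (φ ∧ ψ) h (inj₁ p) (f , g) = nay-sound φ h p f
      nay-sound (φ ∧ ψ) h (inj₂ q) (f , g) = nay-sound ψ h q g
      nay-sound (φ ∨ ψ) h (p , q) f = f ⊆-refl (λ _ → nay-sound φ h p) (λ _ → nay-sound ψ h q)
      nay-sound (∀< t φ) h (a , a<t , p) f = nay-sound φ (agree-∷ a h) p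
        (f a ⊆-refl (lift (subst (a <_) (trans (⟦tm⟧ t h) (sym (⟦wk⟧ t))) a<t)))
      nay-sound (∃< t φ) h p f = f ⊆-refl λ a _ (lift a<t , g) → nay-sound φ (agree-∷ a h)
        (p a (subst (a <_) (trans (⟦wk⟧ t) (sym (⟦tm⟧ t h))) a<t)) g

    decided : ∀ {n} {φ : Formula n k} (δ : Σ⁰₀ φ) ρ → ¬ ¬ (Sat (yea δ) O ρ ⊎ Sat (nay δ) O ρ)
    decided (s ≐ t) ρ = return (case <-cmp (⟦ tm s ⟧ ρ) (⟦ tm t ⟧ ρ) of λ where
      (tri< s<t _ _) → inj₂ (inj₁ s<t)
      (tri≈ _ s≡t _) → inj₁ s≡t
      (tri> _ _ t<s) → inj₂ (inj₂ t<s))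
    decided (s ⋖ t) ρ = return (case ⟦ tm s ⟧ ρ <? ⟦ tm t ⟧ ρ of λ where
      (yes s<t) → inj₁ s<t
      (no s≮t) → inj₂ (subst (⟦ tm t ⟧ ρ <_) (+-comm 1 (⟦ tm s ⟧ ρ)) (s≤s (≮⇒≥ s≮t))))
    decided (t ϵ j) ρ = decide (comp j) (⟦ tm t ⟧ ρ)
    decided ⊥̇       ρ = return (inj₂ refl)
    decided (φ ⇒ ψ) ρ = decided φ ρ >>= λ where
      (inj₂ n) → return (inj₁ (inj₁ n))
      (inj₁ y) → decided ψ ρ >>= λ where
        (inj₁ y′) → return (inj₁ (inj₂ y′))
        (inj₂ n′) → return (inj₂ (y , n′))
    decided (φ ∧ ψ) ρ = decided φ ρ >>= λ where
      (inj₂ n) → return (inj₂ (inj₁ n))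
      (inj₁ y) → decided ψ ρ >>= λ where
        (inj₁ y′) → return (inj₁ (y , y′))
        (inj₂ n′) → return (inj₂ (inj₂ n′))
    decided (φ ∨ ψ) ρ = decided φ ρ >>= λ where
      (inj₁ y) → return (inj₁ (inj₁ y))
      (inj₂ n) → decided ψ ρ >>= λ where
        (inj₁ y′) → return (inj₁ (inj₂ y′))
        (inj₂ n′) → return (inj₂ (n , n′))
    decided (∀< t φ) ρ = lem (Sat (nay (∀< t φ)) O ρ) >>= λ where
      (inj₁ ex) → return (inj₂ ex)
      (inj₂ none) → ¬¬-bounded (⟦ tm t ⟧ ρ) (λ a a<t → decided φ (a ◂ ρ) >>= λ where
          (inj₁ y) → return y
          (inj₂ n) → contradiction (a , a<t , n) none) >>= λ all →
        return (inj₁ all)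
    decided (∃< t φ) ρ = lem (Sat (yea (∃< t φ)) O ρ) >>= λ where
      (inj₁ ex) → return (inj₁ ex)
      (inj₂ none) → ¬¬-bounded (⟦ tm t ⟧ ρ) (λ a a<t → decided φ (a ◂ ρ) >>= λ where
          (inj₂ n) → return n
          (inj₁ y) → contradiction (a , a<t , y) none) >>= λ all →
        return (inj₂ all)

  -- The set is enumerated by the Σ⁰₁ formula and its complement by the negated Π⁰₁ formula; their
  -- equivalence makes the two codes decide every number. So the set already belongs to the world
  -- `u`.
  Δ-comprehension-forced : ∀ {n k} {φ ψ : Formula (suc n) k} → Σ⁰₁ φ → Π⁰₁ ψ →
    ∀ {ρ η w} → Computable η (sets w) → Force ρ η (Δ-comprehension φ ψ) w
  Δ-comprehension-forced {n} {k} {∃₁ φ₀} {∀₁ ψ₀} (∃₁ φ) (∀₁ ψ) {ρ} {η} comp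
    {v} w⊆v iff {u} v⊆u never = never ⊆-refl Y Y≼ λ a →
      (λ {t} _ f → sub⁺ (∃₁ φ₀) (λ _ → refl) (λ _ → refl) {t} (from a {t} (lower f))) ,
      (λ {t} _ f → lift (to a {t} (sub⁻ (∃₁ φ₀) (λ _ → refl) (λ _ → refl) {t} f)))
    where
    comp′ : Computable η (sets u)
    comp′ j = _⊆_.carry v⊆u (_⊆_.carry w⊆v (comp j))
    ∃φ ∃¬ψ : Code
    ∃φ = inst (tabulate ρ) (some (yea comp′ φ))
    ∃¬ψ = inst (tabulate ρ) (some (nay comp′ ψ))
    Y : ℕ → Set
    Y a = Sat ∃φ (totals (sets u)) (const a)
    agree : ∀ a → Agree (a Vector.∷ ρ) (a ◂ prefix (tabulate ρ) (const a))
    agree a = agree-∷ a (agree-prefix ρ)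
    from : ∀ a {t} → ¬ ¬ Y a → Force (a Vector.∷ ρ) η (∃₁ φ₀) t
    from a y t⊆s nev = y λ (z , p) → nev z ⊆-refl (yea-sound comp′ φ (agree-∷ z (agree a)) p)
    to : ∀ a {t} → Force (a Vector.∷ ρ) η (∃₁ φ₀) t → ¬ ¬ Y a
    to a f n = f ⊆-refl λ z _ g → decided comp′ φ (z ◂ a ◂ prefix (tabulate ρ) (const a)) λ where
      (inj₁ y) → n (z , y)
      (inj₂ n) → nay-sound comp′ φ (agree-∷ z (agree a)) n g
    ∃¬ψ-sound : ∀ {a} → Sat ∃¬ψ (totals (sets u)) (const a) → ¬ Y a
    ∃¬ψ-sound {a} (z , n) y =
      nay-sound comp′ ψ (agree-∷ z (agree a)) n
        (proj₁ (iff a) v⊆u (from a {u} (return y)) z)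
    Y≼ : Y ≼ sets u
    Y≼ .pos = ∃φ
    Y≼ .neg = ∃¬ψ
    Y≼ .pos-sound = return
    Y≼ .neg-sound = ∃¬ψ-sound
    Y≼ .decide a = lem (Y a) >>= λ where
      (inj₁ y) → return (inj₁ y)
      (inj₂ ¬y) → lem (Sat ∃¬ψ (totals (sets u)) (const a)) >>= λ where
        (inj₁ n) → return (inj₂ n)
        (inj₂ ¬n) _ → to a {u}
          (proj₂ (iff a) {u} v⊆u λ z → stable ψ₀ λ t⊆s nev →
            decided comp′ ψ (z ◂ a ◂ prefix (tabulate ρ) (const a)) λ where
              (inj₁ y) → nev ⊆-refl (yea-sound comp′ ψ (agree-∷ z (agree a)) y)
              (inj₂ n) → ¬n (z , n))
          ¬y

  -- The worlds have the standard numbers, so induction in the metatheory gives the axiom for every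
  -- formula.
  induction-forced : ∀ {n k} (φ : Formula (suc n) k) {ρ η w} → Force ρ η (induction φ) w
  induction-forced φ {ρ} {η} {w} {v} w⊆v (base , next) = go
    where
    go : ∀ a → Force (a Vector.∷ ρ) η φ v
    go zero    = sub⁻ φ (λ { zero → refl ; (suc i) → refl }) (λ _ → refl) base
    go (suc a) = sub⁻ φ (λ { zero → +-comm a 1 ; (suc i) → refl }) (λ _ → refl)
      (next a ⊆-refl (go a))

  closure-forced : ∀ n k {φ : Formula n k} →
    (∀ w ρ η → Computable η (sets w) → Force ρ η φ w) →
    ∀ w → Force (λ ()) (λ ()) (∀-closure n k φ) w
  closure-forced zero    zero    f w = f w _ _ λ ()
  closure-forced zero    (suc k) f = closure-forced zero k
    λ w ρ η comp {v} w⊆v Y Y≼ → f v _ _ (computable-∷ Y≼ λ j → _⊆_.carry w⊆v (comp j))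
  closure-forced (suc n) k       f = closure-forced n k λ w ρ η comp a → f w _ η comp

  RCA₀-forced : Models RCA₀
  RCA₀-forced _ suc≢0   w x _ (lift x+1≡0) = case trans (+-comm 1 x) x+1≡0 of λ ()
  RCA₀-forced _ suc-inj w x y _ (lift eq) = lift (+-cancelʳ-≡ 1 x y eq)
  RCA₀-forced _ +-zero  w x = lift (+-identityʳ x)
  RCA₀-forced _ +-suc   w x y = lift (sym (+-assoc x y 1))
  RCA₀-forced _ ·-zero  w x = lift (*-zeroʳ x)
  RCA₀-forced _ ·-suc   w x y =
    lift (trans (*-distribˡ-+ x y 1) (cong (x *ℕ y +ℕ_) (*-identityʳ x)))
  RCA₀-forced _ ≮0      w x _ (lift ())
  RCA₀-forced _ <-suc   w x y =
    (λ _ (lift x<y+1) _ n₁ n₂ →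
      case m≤n⇒m<n∨m≡n (s≤s⁻¹ (subst (x <_) (+-comm y 1) x<y+1)) of λ where
        (inj₁ x<y) → n₁ ⊆-refl (lift x<y)
        (inj₂ x≡y) → n₂ ⊆-refl (lift x≡y)) ,
    (λ _ f → lift (decidable-stable (x <? y +ℕ 1) λ x≮ → f ⊆-refl
      (λ _ (lift x<y) → x≮ (≤-trans x<y (m≤m+n y 1)))
      (λ _ (lift x≡y) → x≮ (subst₂ _<_ (sym x≡y) (+-comm 1 y) ≤-refl))))
  RCA₀-forced _ (Σ⁰₁-IND {n} {k} {φ} _) w = closure-forced n k (λ w _ _ _ {v} → induction-forced φ {w = w} {v}) w
  RCA₀-forced _ (Δ⁰₁-CA {n} {k} φ ψ) w =
    closure-forced n k (λ w _ _ comp {v} → Δ-comprehension-forced φ ψ {w = w} comp {v}) w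

-- CAC, ADS and EM in the worlds

-- Under the two quantifiers `var 2` is the argument, to be decoded as a pair. Numbers that are not
-- pairs go to the complement.
rel⁺ rel⁻ : Code → Code
rel⁺ e = some (some (and (equal (var 2) ⌜ var 1 , var 0 ⌝ᵗ) e))
rel⁻ e = or (nonpair (var 0)) (rel⁺ e)

-- A binary relation as the set of its pairs, defined by e with x, y as the
-- variables 1 and 0.
SatPair : Code → Oracles → ℕ → ℕ → Set
SatPair e O x y = Sat e O (y ◂ x ◂ const ⌜ x , y ⌝)

rel⁺-elim : ∀ e {O x y} → Sat (rel⁺ e) O (const ⌜ x , y ⌝) → SatPair e O x y
rel⁺-elim e {x = x} {y} (x′ , y′ , z≡ , p) with refl , refl ← pair-injective {x} {y} {x′} {y′} z≡ = p

rel⁻-elim : ∀ e {O x y} → Sat (rel⁻ e) O (const ⌜ x , y ⌝) → SatPair e O x y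
rel⁻-elim e {x = x} {y} (inj₁ np) = contradiction refl (np x y)
rel⁻-elim e (inj₂ p) = rel⁺-elim e p

rel-exclusive : ∀ e f {O} → (∀ x y → SatPair e O x y → ¬ SatPair f O x y) →
                ∀ {z} → Sat (rel⁺ e) O (const z) → ¬ Sat (rel⁻ f) O (const z)
rel-exclusive e f excl (x , y , refl , p) n = excl x y p (rel⁻-elim f n)

rel-decided : ∀ e f {O} → (∀ x y → ¬ ¬ (SatPair e O x y ⊎ SatPair f O x y)) →
              ∀ z → ¬ ¬ (Sat (rel⁺ e) O (const z) ⊎ Sat (rel⁻ f) O (const z))
rel-decided e f dec z = lem (∃[ x ] ∃[ y ] z ≡ ⌜ x , y ⌝) >>= λ where
  (inj₁ (x , y , refl)) → dec x y >>= λ where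
    (inj₁ p) → return (inj₁ (x , y , refl , p))
    (inj₂ n) → return (inj₂ (inj₂ (x , y , refl , n)))
  (inj₂ none) → return (inj₂ (inj₁ λ x y z≡ → none (x , y , z≡)))

PairSet : (ℕ → ℕ → Set) → ℕ → Set
PairSet R z = ∃[ x ] ∃[ y ] z ≡ ⌜ x , y ⌝ × R x y

pairSet-elim : ∀ {R x y} → PairSet R ⌜ x , y ⌝ → R x y
pairSet-elim {x = x} {y} (x′ , y′ , z≡ , r) with refl , refl ← pair-injective {x} {y} {x′} {y′} z≡ = r

open _≼_

pairSet-≼ : ∀ e f {R X} → (∀ x y → SatPair e (totals X) x y → R x y) →
            (∀ x y → SatPair f (totals X) x y → ¬ R x y) →
            (∀ x y → ¬ ¬ (SatPair e (totals X) x y ⊎ SatPair f (totals X) x y)) →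
            PairSet R ≼ X
pairSet-≼ e f e-sound f-sound dec = record
  { pos = rel⁺ e
  ; neg = rel⁻ f
  ; pos-sound = λ { (x , y , refl , p) → return (x , y , refl , e-sound x y p) }
  ; neg-sound = λ { n (x , y , refl , r) → f-sound x y (rel⁻-elim f n) r }
  ; decide = rel-decided e f dec
  }

weaken-≼ : ∀ {Y G X} → Y ≼ X → Y ≼ (G ◂ X)
weaken-≼ h = record
  { pos = shift (pos h)
  ; neg = shift (neg h)
  ; pos-sound = pos-sound h
  ; neg-sound = neg-sound h
  ; decide = decide h
  }

head-≼ : ∀ {G X} → G ≼ (G ◂ X)
head-≼ {G} = record
  { pos = orc 0 true (var 0)
  ; neg = orc 0 false (var 0)
  ; pos-sound = return
  ; neg-sound = id
  ; decide = λ z → lem (G z)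
  }

-- Listing a set in increasing order

module _ {G : ℕ → Set} where

  count-unique : ∀ a {m n} → Count (total G) a m → Count (total G) a n → m ≡ n
  count-unique zero    refl refl = refl
  count-unique (suc a) (inj₁ (_ , m , refl , p)) (inj₁ (_ , n , refl , q)) =
    cong suc (count-unique a p q)
  count-unique (suc a) (inj₁ (g , _)) (inj₂ (¬g , _)) = contradiction g ¬g
  count-unique (suc a) (inj₂ (¬g , _)) (inj₁ (g , _)) = contradiction g ¬g
  count-unique (suc a) (inj₂ (_ , p)) (inj₂ (_ , q)) = count-unique a p q

  count-total : ∀ a → ¬ ¬ (∃[ n ] Count (total G) a n)
  count-total zero    = return (0 , refl)
  count-total (suc a) = count-total a >>= λ (n , p) → lem (G a) >>= λ where
    (inj₁ g) → return (suc n , inj₁ (g , n , refl , p))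
    (inj₂ ¬g) → return (n , inj₂ (¬g , p))

  count-< : ∀ {a m} b {n} → G a → Count (total G) a m → Count (total G) b n → a < b → m < n
  count-< {a} (suc b) g p (inj₁ (_ , n , refl , q)) (s≤s a≤b) = case m≤n⇒m<n∨m≡n a≤b of λ where
    (inj₁ a<b) → m≤n⇒m≤1+n (count-< b g p q a<b)
    (inj₂ refl) → s≤s (≤-reflexive (count-unique a p q))
  count-< (suc b) g p (inj₂ (¬g , q)) (s≤s a≤b) = case m≤n⇒m<n∨m≡n a≤b of λ where
    (inj₁ a<b) → count-< b g p q a<b
    (inj₂ refl) → contradiction g ¬g

  count-injective : ∀ {a b n} → G a → G b → Count (total G) a n → Count (total G) b n → a ≡ b
  count-injective {a} {b} ga gb p q = case <-cmp a b of λ where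
    (tri≈ _ a≡b _) → a≡b
    (tri< a<b _ _) → contradiction (count-< b ga p q a<b) (<-irrefl refl)
    (tri> _ _ b<a) → contradiction (count-< a gb q p b<a) (<-irrefl refl)

  count-reflects-< : ∀ {a b m n} → G a → G b → Count (total G) a m → Count (total G) b n →
                     m < n → a < b
  count-reflects-< {a} {b} ga gb p q m<n = case <-cmp a b of λ where
    (tri< a<b _ _) → a<b
    (tri≈ _ refl _) → contradiction m<n (<-irrefl (count-unique a p q))
    (tri> _ _ b<a) → contradiction m<n (<⇒≯ (count-< a gb q p b<a))

  module _ (infinite : InfiniteSet G) where

    -- The search climbs from `a` to the next element of `G`, passing only non-elements, which leave
    -- the count unchanged. An element beyond `a` bounds it.
    count-next : ∀ a {n} → Count (total G) a n → ¬ ¬ (∃[ b ] G b × Count (total G) b n)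
    count-next a p = infinite a >>= λ (z , a≤z , g) →
      search (z ∸ a) a (subst G (sym (m∸n+n≡m a≤z)) g) p
      where
      search : ∀ d a {n} → G (d +ℕ a) → Count (total G) a n →
               ¬ ¬ (∃[ b ] G b × Count (total G) b n)
      search zero    a g p = return (a , g , p)
      search (suc d) a g p = lem (G a) >>= λ where
        (inj₁ ga) → return (a , ga , p)
        (inj₂ ¬ga) → search d (suc a) (subst G (sym (Data.Nat.Properties.+-suc d a)) g) (inj₂ (¬ga , p))

    count-surjective : ∀ n → ¬ ¬ (∃[ a ] G a × Count (total G) a n)
    count-surjective zero    = count-next 0 refl
    count-surjective (suc n) = count-surjective n >>= λ (a , g , p) →
      count-next (suc a) (inj₁ (g , n , refl , p))

-- Forcing the principles

module Principles {c : ℕ → Set} where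
  open Forcing c
  open _⊆_

  adjoin : ∀ (w : World c) G → Generic c (G ◂ sets w) → World c
  adjoin w G gen = record { sets = G ◂ sets w ; generic = gen }

  -- A homogeneous set is adjoined to the world, and genericity makes the result a world again.
  -- Ascending and descending sets are both chains.
  CAC-forced : ∀ w → Force (λ ()) (λ ()) CAC w
  CAC-forced w {v} _ M M≼v {u} v⊆u (rfl , anti , trans′) {t} u⊆t never =
    homogeneous-set (generic t) (pos M≼) (neg M≼) order λ (k , G , inf , gen , hom) →
    never {adjoin t G gen} (mk⊆ weaken-≼) G head-≼ (infinite-forced inf , shape k hom)
    where
    M≼ : M ≼ sets t
    M≼ = carry u⊆t (carry v⊆u M≼v)
    order : IsOrder _
    order = record
      { exclusive = λ p n → pos-sound M≼ p (neg-sound M≼ n)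
      ; decided = decide M≼
      ; antisym = λ {x} {y} p q → lower
          (anti x y ⊆-refl (lift (pos-sound M≼ p)) ⊆-refl (lift (pos-sound M≼ q)))
      ; transit = λ x y z p q →
          lower (trans′ x y z ⊆-refl (lift (pos-sound M≼ p)) ⊆-refl (lift (pos-sound M≼ q)))
          >>= pos-complete M≼
      }
    infinite-forced : ∀ {G s} → InfiniteSet G →
      Force {0} (λ ()) (G Vector.∷ M Vector.∷ Vector.[]) (IsInfinite zero) s
    infinite-forced inf a _ none = inf (suc a) λ (z , a<z , Gz) →
      none z ⊆-refl (lift a<z , lift (return Gz))
    shape : ∀ {G s} k →
      (∀ x y → G x → G y → x < y → Col ⟪ (λ z → Sat (pos M≼) (totals (sets t)) (const z)) ,
                                          (λ z → Sat (neg M≼) (totals (sets t)) (const z)) ⟫ k x y) →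
      Force {0} (λ ()) (G Vector.∷ M Vector.∷ Vector.[])
        (IsChain (suc zero) zero ∨ IsAntichain (suc zero) zero) s
    shape ≺ hom _ n₁ _ = n₁ ⊆-refl λ x y _ (lift Gx) _ (lift Gy) _ m₁ m₂ →
      Gx λ gx → Gy λ gy → case <-cmp x y of λ where
        (tri< x<y _ _) → m₁ ⊆-refl (lift (pos-sound M≼ (hom x y gx gy x<y)))
        (tri≈ _ refl _) → m₁ ⊆-refl (rfl x)
        (tri> _ _ y<x) → m₂ ⊆-refl (lift (pos-sound M≼ (hom y x gy gx y<x)))
    shape ≻ hom _ n₁ _ = n₁ ⊆-refl λ x y _ (lift Gx) _ (lift Gy) _ m₁ m₂ →
      Gx λ gx → Gy λ gy → case <-cmp x y of λ where
        (tri< x<y _ _) → m₂ ⊆-refl (lift (pos-sound M≼ (hom x y gx gy x<y)))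
        (tri≈ _ refl _) → m₁ ⊆-refl (rfl x)
        (tri> _ _ y<x) → m₁ ⊆-refl (lift (pos-sound M≼ (hom y x gy gx y<x)))
    shape ∥ hom _ _ n₂ = n₂ ⊆-refl λ x y _ (lift Gx) _ (lift Gy) _ x≢y ⊆r f →
      lift (Gx λ gx → Gy λ gy → case <-cmp x y of λ where
        (tri< x<y _ _) → let (n , n′) = hom x y gx gy x<y in
          f ⊆-refl (λ _ m → lower m (neg-sound M≼ n)) (λ _ m → lower m (neg-sound M≼ n′))
        (tri≈ _ x≡y _) → lower (x≢y ⊆r (lift x≡y))
        (tri> _ _ y<x) → let (n , n′) = hom y x gy gx y<x in
          f ⊆-refl (λ _ m → lower m (neg-sound M≼ n′)) (λ _ m → lower m (neg-sound M≼ n)))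

  -- A homogeneous set of a suitable partial order is listed increasingly: the function takes `n` to
  -- the element of `G` with exactly `n` elements of `G` below it.
  ADS-forced : ∀ w → Force (λ ()) (λ ()) ADS w
  ADS-forced w {v} _ L L≼v {u} v⊆u (irrefl , trans′ , tri) {t} u⊆t never =
    homogeneous-set (generic t) (rel⁺ e) (rel⁻ f) order λ (k , G , inf , gen , hom) →
    never {adjoin t G gen} (mk⊆ weaken-≼) (graph G) graph-≼
      (graph-function inf , shape k inf hom)
    where
    L≼ : L ≼ sets t
    L≼ = carry u⊆t (carry v⊆u L≼v)

    O : Oracles
    O = totals (sets t)

    -- The partial order whose ascending sets and antichains are the sets on
    -- which < agrees with L, respectively with the reverse of L.
    e f : Code
    e = or (equal (var 1) (var 0))
           (and (less (var 1) (var 0)) (call (pos L≼) ⌜ var 1 , var 0 ⌝ᵗ))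
    f = or (less (var 0) (var 1))
           (and (less (var 1) (var 0)) (call (neg L≼) ⌜ var 1 , var 0 ⌝ᵗ))

    P : PSet
    P = ⟪ (λ z → Sat (rel⁺ e) O (const z)) , (λ z → Sat (rel⁻ f) O (const z)) ⟫

    order : IsOrder P
    order = record
      { exclusive = rel-exclusive e f λ where
          x y (inj₁ refl) (inj₁ x<x) → <-irrefl refl x<x
          x y (inj₁ refl) (inj₂ (x<x , _)) → <-irrefl refl x<x
          x y (inj₂ (x<y , _)) (inj₁ y<x) → <⇒≯ x<y y<x
          x y (inj₂ (_ , p)) (inj₂ (_ , n)) → pos-sound L≼ p (neg-sound L≼ n)
      ; decided = rel-decided e f λ x y → case <-cmp x y of λ where
          (tri≈ _ x≡y _) → return (inj₁ (inj₁ x≡y))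
          (tri> _ _ y<x) → return (inj₂ (inj₁ y<x))
          (tri< x<y _ _) → decide L≼ ⌜ x , y ⌝ >>= λ where
            (inj₁ p) → return (inj₁ (inj₂ (x<y , p)))
            (inj₂ n) → return (inj₂ (inj₂ (x<y , n)))
      ; antisym = λ {x} {y} p q → case rel⁺-elim e {O} {x} {y} p , rel⁺-elim e {O} {y} {x} q of λ where
          (inj₁ x≡y , _) → x≡y
          (inj₂ _ , inj₁ y≡x) → sym y≡x
          (inj₂ (x<y , _) , inj₂ (y<x , _)) → contradiction y<x (<⇒≯ x<y)
      ; transit = λ x y z p q → case rel⁺-elim e {O} {x} {y} p , rel⁺-elim e {O} {y} {z} q of λ where
          (inj₁ refl , _) → return q
          (inj₂ _ , inj₁ refl) → return p
          (inj₂ (x<y , p) , inj₂ (y<z , q)) →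
            lower (trans′ x y z ⊆-refl (lift (pos-sound L≼ p)) ⊆-refl (lift (pos-sound L≼ q)))
            >>= pos-complete L≼ >>= λ r →
            return (x , z , refl , inj₂ (<-trans x<y y<z , r))
      }

    Nth : (ℕ → Set) → ℕ → ℕ → Set
    Nth G n a = G a × Count (total G) a n

    graph : (ℕ → Set) → ℕ → Set
    graph G = PairSet (Nth G)

    graph-≼ : ∀ {G X} → graph G ≼ (G ◂ X)
    graph-≼ {G} = pairSet-≼
      (and (orc 0 true (var 0)) (count (var 0) (var 1)))
      (or (orc 0 false (var 0))
          (some (and (count (var 1) (var 0)) (or (less (var 0) (var 2)) (less (var 2) (var 0))))))
      (λ n a p → p)
      (λ where
        n a (inj₁ ¬g) (g , _) → ¬g g
        n a (inj₂ (m , p , inj₁ m<n)) (_ , q) → <⇒≢ m<n (count-unique a p q)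
        n a (inj₂ (m , p , inj₂ n<m)) (_ , q) → >⇒≢ n<m (count-unique a p q))
      (λ n a → lem (G a) >>= λ where
        (inj₂ ¬g) → return (inj₂ (inj₁ ¬g))
        (inj₁ g) → count-total a >>= λ (m , p) → case <-cmp m n of λ where
          (tri≈ _ refl _) → return (inj₁ (g , p))
          (tri< m<n _ _) → return (inj₂ (inj₂ (m , p , inj₁ m<n)))
          (tri> _ _ n<m) → return (inj₂ (inj₂ (m , p , inj₂ n<m))))

    graph-function : ∀ {G s} → InfiniteSet G →
      Force {0} (λ ()) (graph G Vector.∷ L Vector.∷ Vector.[]) (IsFunction zero) s
    graph-function {G} inf =
      (λ z _ (lift Fz) _ none → Fz λ (x , y , z≡ , _) →
        none x ⊆-refl λ _ none′ → none′ y ⊆-refl (lift z≡)) ,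
      λ n _ none → count-surjective inf n λ (a , g , p) →
        none a ⊆-refl (lift (return (n , a , refl , g , p)) , λ b _ (lift Fb) →
          lift (decidable-stable (b ≟ a) λ b≢a → Fb λ nb →
            let (g′ , p′) = pairSet-elim {Nth G} nb in b≢a (count-injective g′ g p′ p)))

    shape : ∀ {G s} k → InfiniteSet G → (∀ x y → G x → G y → x < y → Col P k x y) →
      Force {0} (λ ()) (graph G Vector.∷ L Vector.∷ Vector.[])
        (IsAscending (suc zero) zero ∨ IsDescending (suc zero) zero) s
    shape {G} ≺ inf hom _ n₁ _ = n₁ ⊆-refl λ x y a b _ (lift x<y) _ (lift Fa) _ (lift Fb) →
      lift (Fa >>= λ na → Fb >>= λ nb →
        let (ga , p) = pairSet-elim {Nth G} na ; (gb , q) = pairSet-elim {Nth G} nb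
            a<b = count-reflects-< ga gb p q x<y in
        case rel⁺-elim e {O} {a} {b} (hom a b ga gb a<b) of λ where
          (inj₁ a≡b) → contradiction a≡b (<⇒≢ a<b)
          (inj₂ (_ , r)) → pos-sound L≼ r)
    shape {G} ∥ inf hom _ _ n₂ = n₂ ⊆-refl λ x y a b _ (lift x<y) _ (lift Fa) _ (lift Fb) →
      lift (Fa >>= λ na → Fb >>= λ nb →
        let (ga , p) = pairSet-elim {Nth G} na ; (gb , q) = pairSet-elim {Nth G} nb
            a<b = count-reflects-< ga gb p q x<y in
        case rel⁻-elim f {O} {a} {b} (proj₁ (hom a b ga gb a<b)) of λ where
          (inj₁ b<a) → contradiction b<a (<⇒≯ a<b)
          (inj₂ (_ , r)) n → tri a b ⊆-refl
            (λ _ Lab → lower Lab (neg-sound L≼ r))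
            λ _ rest → rest ⊆-refl
              (λ _ (lift a≡b) → <⇒≢ a<b a≡b)
              (λ _ Lba → lower Lba n))
    -- The order is contained in the natural one, so two elements of a descending set already give a
    -- contradiction.
    shape ≻ inf hom _ _ _ =
      inf 0 λ (a , _ , ga) → inf (suc a) λ (b , a<b , gb) →
      case rel⁺-elim e {O} {b} {a} (hom a b ga gb a<b) of λ where
        (inj₁ b≡a) → >⇒≢ a<b b≡a
        (inj₂ (b<a , _)) → <⇒≯ a<b b<a

-- For x < y the edge between x and y is directed from x to y iff ⌜ x , y ⌝ lies
-- in U, hence for almost all y iff x has colour c.
module Tournament where
  open GenericColouring
  open Forcing c
  open Principles {c}
  open _⊆_

  base : World c
  base = record { sets = U ◂ ∅ ; generic = U-generic }

  Edge : ℕ → ℕ → Set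
  Edge x y = (x < y × U ⌜ x , y ⌝) ⊎ (y < x × ¬ U ⌜ y , x ⌝)

  edge-asym : ∀ {x y} → Edge x y → ¬ Edge y x
  edge-asym (inj₁ (_ , u)) (inj₂ (_ , ¬u)) = ¬u u
  edge-asym (inj₂ (_ , ¬u)) (inj₁ (_ , u)) = ¬u u
  edge-asym (inj₁ (x<y , _)) (inj₁ (y<x , _)) = <⇒≯ x<y y<x
  edge-asym (inj₂ (y<x , _)) (inj₂ (x<y , _)) = <⇒≯ x<y y<x

  edge-total : ∀ {x y} → x ≢ y → ¬ ¬ (Edge x y ⊎ Edge y x)
  edge-total {x} {y} x≢y = case <-cmp x y of λ where
    (tri≈ _ x≡y _) → contradiction x≡y x≢y
    (tri< x<y _ _) → lem (U ⌜ x , y ⌝) >>= λ where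
      (inj₁ u) → return (inj₁ (inj₁ (x<y , u)))
      (inj₂ ¬u) → return (inj₂ (inj₂ (x<y , ¬u)))
    (tri> _ _ y<x) → lem (U ⌜ y , x ⌝) >>= λ where
      (inj₁ u) → return (inj₂ (inj₁ (y<x , u)))
      (inj₂ ¬u) → return (inj₁ (inj₂ (y<x , ¬u)))

  K : ℕ → Set
  K = PairSet Edge

  K≼ : K ≼ sets base
  K≼ = pairSet-≼
    (or (and (less (var 1) (var 0)) (orc 0 true ⌜ var 1 , var 0 ⌝ᵗ))
        (and (less (var 0) (var 1)) (orc 0 false ⌜ var 0 , var 1 ⌝ᵗ)))
    (or (equal (var 1) (var 0))
        (or (and (less (var 0) (var 1)) (orc 0 true ⌜ var 0 , var 1 ⌝ᵗ))
            (and (less (var 1) (var 0)) (orc 0 false ⌜ var 1 , var 0 ⌝ᵗ))))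
    (λ x y p → p)
    (λ where
      x y (inj₁ refl) e → edge-asym e e
      x y (inj₂ e) e′ → edge-asym e e′)
    (λ x y → case x ≟ y of λ where
      (yes x≡y) → return (inj₂ (inj₁ x≡y))
      (no x≢y) → edge-total x≢y >>= λ where
        (inj₁ e) → return (inj₁ e)
        (inj₂ e) → return (inj₂ (inj₂ e)))

  edge : ∀ x y → Edge x y → K ⌜ x , y ⌝
  edge x y e = x , y , refl , e

  K-tournament : ∀ {w} → Force {0} (λ ()) (K Vector.∷ Vector.[]) (IsTournament zero) w
  K-tournament =
    (λ x _ (lift Kxx) → lift (Kxx λ k → let e = pairSet-elim {Edge} {x} k in edge-asym e e)) ,
    λ x y {v} _ x≢y →
      (λ v⊆u n₁ n₂ → edge-total {x} {y} (λ x≡y → lower (x≢y ⊆-refl (lift x≡y))) λ where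
        (inj₁ e) → n₁ ⊆-refl (lift (return (edge x y e)))
        (inj₂ e) → n₂ ⊆-refl (lift (return (edge y x e)))) ,
      λ _ (lift Kxy , lift Kyx) → lift (Kxy λ k → Kyx λ k′ →
        edge-asym (pairSet-elim {Edge} {x} k) (pairSet-elim {Edge} {y} k′))

  module _ {w} (base⊆w : base ⊆ w) {S} (S≼ : S ≼ sets w) (infinite : InfiniteSet S)
    (transitive : ∀ x y z → S x → S y → S z → Edge x y → Edge y z → ¬ ¬ Edge x z) where

    K≼w : K ≼ sets w
    K≼w = carry base⊆w K≼

    -- An edge `a → b` in `S` with `a` coloured false and `b` true: then `b → y → a` for almost all
    -- `y`. The codes are shifted because oracle 0 is the colouring.
    bad : Code
    bad = some (some (and (and (call (shift (pos S≼)) (var 1)) (call (shift (pos S≼)) (var 0)))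
                     (and (call (shift (pos K≼w)) ⌜ var 1 , var 0 ⌝ᵗ)
                          (and (orc 0 false (var 1)) (orc 0 true (var 0))))))

    not-transitive : ⊥
    not-transitive = generic w bad λ where
      (inj₁ (a , b , (Sa , Sb) , Kab , ¬ca , cb)) →
        pos-sound S≼ Sa λ Sa → pos-sound S≼ Sb λ Sb → pos-sound K≼w Kab λ Kab →
        U-limit a λ (k , lim-a) → U-limit b λ (l , lim-b) →
        -- The vertex `y` of `S` lies beyond `a` and `b` and beyond the points where their edges
        -- have settled.
        infinite (suc a ⊔ suc b ⊔ (k ⊔ l)) λ (y , ≤y , Sy) →
        let
          a<y = ≤-trans (m≤m⊔n (suc a) (suc b)) (≤-trans (m≤m⊔n _ (k ⊔ l)) ≤y)
          b<y = ≤-trans (m≤n⊔m (suc a) (suc b)) (≤-trans (m≤m⊔n _ (k ⊔ l)) ≤y)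
          k≤y = ≤-trans (m≤m⊔n k l) (≤-trans (m≤n⊔m (suc a ⊔ suc b) _) ≤y)
          l≤y = ≤-trans (m≤n⊔m k l) (≤-trans (m≤n⊔m (suc a ⊔ suc b) _) ≤y)
        in
        proj₁ (lim-b y l≤y) cb λ Uby →
        transitive a b y Sa Sb Sy (pairSet-elim {Edge} {a} Kab) (inj₁ (b<y , Uby)) λ where
          (inj₁ (_ , Uay)) → ¬ca (proj₂ (lim-a y k≤y) Uay)
          (inj₂ (y<a , _)) → <⇒≯ a<y y<a
      (inj₂ (n , none)) →
        let
          refute : ∀ a b → n ≤ a → n ≤ b → S a → S b → ¬ Edge a b
          refute = λ a b n≤a n≤b Sa Sb e →
            pos-complete S≼ Sa λ Sa → pos-complete S≼ Sb λ Sb →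
            pos-complete K≼w (edge a b e) λ Kab →
            -- The colouring that is true at the head of the edge only.
            none (λ z → does (z ≟ b)) (suc (a ⊔ b)) (a , b , (Sa , Sb) , Kab ,
              (n≤a , s≤s (m≤m⊔n a b) , dec-false (a ≟ b) λ { refl → edge-asym e e }) ,
              (n≤b , s≤s (m≤n⊔m a b) , dec-true (b ≟ b) refl))
        in
        -- Any two vertices of `S` from `n` on are joined by an edge in one direction, and either
        -- direction is refuted.
        infinite n λ (a , n≤a , Sa) → infinite (suc a) λ (b , a<b , Sb) →
        let n≤b = ≤-trans n≤a (<⇒≤ a<b) in
        edge-total (<⇒≢ a<b) λ where
          (inj₁ e) → refute a b n≤a n≤b Sa Sb e
          (inj₂ e) → refute b a n≤b n≤a Sb Sa e

  EM-fails : ¬ Force (λ ()) (λ ()) EM base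
  EM-fails f = f ⊆-refl K K≼ ⊆-refl K-tournament ⊆-refl λ base⊆w S S≼ (inf , trans′) →
    not-transitive base⊆w S≼
      (λ k none → inf k ⊆-refl λ z _ (lift k<z , lift Sz) → Sz λ s → none (z , <⇒≤ k<z , s))
      λ x y z Sx Sy Sz e e′ →
        lower (trans′ x y z ⊆-refl (lift (return Sx)) ⊆-refl (lift (return Sy))
          ⊆-refl (lift (return Sz)) ⊆-refl (lift (return (edge x y e)))
          ⊆-refl (lift (return (edge y z e′))))
        >>= λ k → return (pairSet-elim {Edge} {x} k)

corollary1p12 : ¬ (RCA₀ ∪ ｛ CAC ｝ ⊢ EM) × ¬ (RCA₀ ∪ ｛ ADS ｝ ⊢ EM)
corollary1p12 = unprovable CAC-forced , unprovable ADS-forced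
  where
  open Tournament
  open Forcing GenericColouring.c
  open Principles {GenericColouring.c}
  open Comprehension {GenericColouring.c}

  unprovable : ∀ {φ} → (∀ w → Force (λ ()) (λ ()) φ w) → ¬ (RCA₀ ∪ ｛ φ ｝ ⊢ EM)
  unprovable {φ} forced d = EM-fails (sound model d {λ ()} {λ ()} {base} (λ ()) λ ())
    where
    model : Models (RCA₀ ∪ ｛ φ ｝)
    model ψ (inj₁ ax) w = RCA₀-forced ψ ax w
    model _ (inj₂ refl) w = forced w
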